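{- Let $n\ge1$ and $t\ge y\ge0$ be integers with $t\equiv y\pmod2$. Then $$\bar M^{(n)}_t(y;1)=1+\frac{n(y+2n+1)(t-y)}{(y+n)(t+y+4n)}.$$
   Context: A walk is a lattice path in $\mathbb Z^2$ with steps $(1,1)$ and $(1,-1)$ never going below the $x$-axis. A family of walks is vicious if no two of its walks share a lattice point. A contact is a lattice point on the $x$-axis lying on one of the walks (starting and end points included); $c(\mathbf P)$ is the total number of contacts of a family $\mathbf P$. $Z^{(n)}_t(y;\kappa)=\sum_{\mathbf P}\kappa^{c(\mathbf P)}$, summed over vicious families $(P_1,\dots,P_n)$ with $P_i$ running from $(0,2i-2)$ to $(t,y+2i-2)$. The normalized mean number of contacts is $\bar M^{(n)}_t(y;\kappa)=\kappa\frac{d}{d\kappa}Z^{(n)}_t(y;\kappa)\big/Z^{(n)}_t(y;\kappa)$. -}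

module Defs where

open import Data.Bool using (Bool; true; false; _∧_; _∨_; not; if_then_else_)
open import Data.Nat as ℕ using (ℕ; zero; suc; _+_; _*_; _∸_; _≡ᵇ_)
open import Data.List using (List; []; _∷_; map; concatMap; filter; length; foldr; zipWith; replicate)
open import Data.Bool.ListAction using (and)
open import Data.Nat.ListAction using (sum)
open import Data.Maybe using (Maybe; just; nothing)
open import Data.Integer using (+_)
open import Data.Rational as ℚ using (ℚ; 0ℚ; 1ℚ; _÷_; ≢-nonZero)
open import Relation.Binary.PropositionalEquality using (_≢_)
open import Relation.Nullary.Decidable using (yes; no)

-- Walks.
-- A walk of length t is encoded by its list of t steps
-- (true = (1,1), false = (1,-1)) together with its starting height.
-- `heights h s` is the list of heights at x = 0,1,…,t of the walk
-- starting at (0,h) with steps s, or `nothing` if it goes below the x-axis.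

heights : ℕ → List Bool → Maybe (List ℕ)
heights h []             = just (h ∷ [])
heights h (true ∷ s)     with heights (suc h) s
... | just hs = just (h ∷ hs)
... | nothing = nothing
heights zero (false ∷ s) = nothing
heights (suc h) (false ∷ s) with heights h s
... | just hs = just (suc h ∷ hs)
... | nothing = nothing

stepSeqs : ℕ → List (List Bool)
stepSeqs zero    = [] ∷ []
stepSeqs (suc t) = concatMap (λ s → (true ∷ s) ∷ (false ∷ s) ∷ []) (stepSeqs t)

last : ℕ → List ℕ → ℕ
last d []       = d
last d (x ∷ xs) = last x xs

walks : (t a b : ℕ) → List (List ℕ)
walks t a b = concatMap pick (stepSeqs t)
  where
  pick : List Bool → List (List ℕ)
  pick s with heights a s
  ... | nothing = []
  ... | just hs = if last a hs ≡ᵇ b then hs ∷ [] else []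

tuples : (n t y off : ℕ) → List (List (List ℕ))
tuples zero    t y off = [] ∷ []
tuples (suc n) t y off =
  concatMap (λ p → map (p ∷_) (tuples n t y (2 + off))) (walks t off (y + off))

disjoint : List ℕ → List ℕ → Bool
disjoint p q = and (zipWith (λ a b → not (a ≡ᵇ b)) p q)

vicious : List (List ℕ) → Bool
vicious []       = true
vicious (p ∷ ps) = and (map (disjoint p) ps) ∧ vicious ps

families : (n t y : ℕ) → List (List (List ℕ))
families n t y = filter (λ P → Data.Bool._≟_ (vicious P) true) (tuples n t y 0)
  where import Data.Bool

contacts : List (List ℕ) → ℕ
contacts P = sum (map (λ p → length (filter (λ h → h ℕ.≟ 0) p)) P)

-- Polynomials in κ with ℕ coefficients (coefficient list, constant first).

Poly : Set
Poly = List ℕ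

_⊕_ : Poly → Poly → Poly
[]       ⊕ q        = q
p        ⊕ []       = p
(a ∷ p) ⊕ (b ∷ q) = (a + b) ∷ (p ⊕ q)

mono : ℕ → Poly
mono c = replicate c 0 ++ (1 ∷ [])
  where open Data.List using (_++_)

κD : Poly → Poly
κD p = go 0 p
  where
  go : ℕ → Poly → Poly
  go i []       = []
  go i (a ∷ as) = (i * a) ∷ go (suc i) as

eval : Poly → ℚ → ℚ
eval []       κ = 0ℚ
eval (a ∷ as) κ = ℚ._+_ ((+ a) ℚ./ 1) (ℚ._*_ κ (eval as κ))

Z : (n t y : ℕ) → Poly
Z n t y = foldr _⊕_ [] (map (λ P → mono (contacts P)) (families n t y))

-- normalized mean number of contacts  κ Z'(κ) / Z(κ)  (needs Z(κ) ≠ 0)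
Mbar : (n t y : ℕ) (κ : ℚ) → eval (Z n t y) κ ≢ 0ℚ → ℚ
Mbar n t y κ nz = _÷_ (eval (κD (Z n t y)) κ) (eval (Z n t y) κ) {{≢-nonZero nz}}

-- right-hand side 1 + n(y+2n+1)(t-y) / ((y+n)(t+y+4n)), for n ≥ 1
-- (the denominator is written as (n+y)(4n+(t+y)) so that its
--  non-zeroness is visible definitionally when n = suc m; n = 0 is excluded
--  by the theorem's hypothesis and given a dummy value)
rhs : (n t y : ℕ) → ℚ
rhs zero    t y = 1ℚ
rhs (suc m) t y =
  ℚ._+_ 1ℚ ((+ (n * (y + 2 * n + 1) * (t ∸ y))) ℚ./ ((n + y) * (4 * n + (t + y))))
  where n = suc m

{-# OPTIONS --safe #-}
-- Put x = h + 1, so that the wall becomes the zero set of odd functions. The free n-particle evolution of the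
-- antisymmetrised, odd point mass at (1,3,…,2n−1) vanishes whenever two coordinates agree or one is 0, hence on
-- the chamber it counts the vicious families (reflection principle); write N_t(x) for it.
--
-- Contacts: the total number of contacts of the families ending at x is N_t(x) + Σ_j N_t(x + 2e_j). Both sides
-- satisfy the same recursion, since at x₁ = 0 the right-hand side is N_t(2,x₂,…), which is exactly what a free
-- step loses at the wall. At the flat end point only j = n survives, so the mean number of contacts is 1 plus
-- the ratio of N_t at the end point with its top raised by 2 to N_t at the end point.
--
-- Ratio: the second-order difference operators Σ_j H_j, where
--   (H f)(x) = (x+p)(x+q) f(x+2) + (p−x)(q−x) f(x−2) + (2x² + 2p(2−q)) f(x),  p = t + a,  q = t + 2n + 1,
-- intertwine the evolution, and the initial state is an eigenvector. With a chosen such that H does not lower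
-- the bottom walker, the eigenvalue equation at the flat end point is a linear relation between the two values.
module Submission where

open import Defs
open import Data.Nat using (ℕ; _≤_; _%_)
open import Data.Product using (Σ)
open import Data.Rational using (1ℚ; 0ℚ)
open import Relation.Binary.PropositionalEquality using (_≡_; _≢_)

open import Data.Bool using (Bool; true; false; if_then_else_; _∧_; not)
open import Data.Bool.ListAction using (and)
open import Data.Bool.Properties using (∧-zeroʳ; ∧-identityʳ)
open import Data.Integer as ℤ using (ℤ; +_; 0ℤ; 1ℤ; _+_; _*_; -_; _-_; pred) renaming (suc to sucℤ)
open import Data.Integer.Properties as ℤP using (suc-pred; pred-suc)
open import Data.Integer.Tactic.RingSolver using (solve-∀)
open import Data.List using (List; []; _∷_; _++_; map; filter; length; zipWith; concatMap; foldr)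
open import Data.List.Relation.Unary.All as All using (All; []; _∷_)
open import Data.Maybe using (Maybe; just; nothing)
open import Data.Nat as ℕ using (zero; suc; _≡ᵇ_; _<_; _∸_; z≤n; s≤s)
open import Data.Nat.Properties as ℕP using ()
open import Data.Nat.Tactic.RingSolver as ℕSolver using ()
open import Data.Product using (∃; _,_; proj₁)
open import Data.Rational as ℚ using (ℚ)
open import Data.Rational.Properties as ℚP using ()
open import Data.Rational.Unnormalised as ℚᵘ using (mkℚᵘ; *≡*)
open import Data.Rational.Unnormalised.Properties as ℚᵘP using ()
open import Data.Sum using (_⊎_; inj₁; inj₂)
open import Data.Unit using (⊤; tt)
open import Relation.Binary.PropositionalEquality using (refl; sym; trans; cong; cong₂; subst; subst₂; module ≡-Reasoning)
open import Relation.Nullary using (yes; no; contradiction; does)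
open ≡-Reasoning

-- Operators on functions of a list of integers

-- The constants in H are forced one at a time. The operator sends the top mass at 2n - 1 to 2n + 1
-- with the coefficient (p - x)(q - x) taken at x = 2n + 1, and q = 2n + 1 at time 0 removes this
-- move. Since the odd point mass at -1 is minus the one at 1, the lowest mass moved down reproduces
-- the state, so the initial state is an eigenvector whatever a is. The choice a = y + 1 - t then
-- gives p = y + 1 at time t, a root of the same coefficient at the bottom end point. No count is
-- ever evaluated: the eigenvalue and the diagonal part at the end point are both built from sums of
-- quadratics over progressions of step 2, and only their difference enters. Two mismatches shape
-- the rest. Families are encoded from their starting side, while the evolution acts on end points;
-- the symmetry of the joint step matrix reconciles them. And the function that counts contacts is
-- alternating but not odd, so for it the wall has to be examined separately.

Fun : Set
Fun = List ℤ → ℤ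

infix 4 _≗₀_
_≗₀_ : Fun → Fun → Set
F ≗₀ G = ∀ xs → F xs ≡ G xs

-- The free joint step: there is no wall and no exclusion. Both enter only through the symmetries of
-- `F`.
hop : Fun → Fun
hop F []       = F []
hop F (x ∷ xs) = hop (λ v → F (sucℤ x ∷ v)) xs + hop (λ v → F (pred x ∷ v)) xs

hop-cong : ∀ {F G} → F ≗₀ G → hop F ≗₀ hop G
hop-cong e []       = e []
hop-cong e (x ∷ xs) = cong₂ _+_ (hop-cong (λ v → e (sucℤ x ∷ v)) xs) (hop-cong (λ v → e (pred x ∷ v)) xs)

interchange : ∀ a b c d → (a + b) + (c + d) ≡ (a + c) + (b + d)
interchange = solve-∀

hop-+ : ∀ F G → hop (λ v → F v + G v) ≗₀ λ v → hop F v + hop G v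
hop-+ F G []       = refl
hop-+ F G (x ∷ xs) = trans
  (cong₂ _+_ (hop-+ (λ v → F (sucℤ x ∷ v)) (λ v → G (sucℤ x ∷ v)) xs)
             (hop-+ (λ v → F (pred x ∷ v)) (λ v → G (pred x ∷ v)) xs))
  (interchange (hop (λ v → F (sucℤ x ∷ v)) xs) (hop (λ v → G (sucℤ x ∷ v)) xs) _ _)

hop-* : ∀ c F → hop (λ v → c * F v) ≗₀ λ v → c * hop F v
hop-* c F []       = refl
hop-* c F (x ∷ xs) = trans
  (cong₂ _+_ (hop-* c (λ v → F (sucℤ x ∷ v)) xs) (hop-* c (λ v → F (pred x ∷ v)) xs))
  (sym (ℤP.*-distribˡ-+ c _ _))

hop-neg : ∀ F → hop (λ v → - F v) ≗₀ λ v → - hop F v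
hop-neg F []       = refl
hop-neg F (x ∷ xs) = trans
  (cong₂ _+_ (hop-neg (λ v → F (sucℤ x ∷ v)) xs) (hop-neg (λ v → F (pred x ∷ v)) xs))
  (sym (ℤP.neg-distrib-+ (hop (λ v → F (sucℤ x ∷ v)) xs) _))

-- Second-order difference operators acting on one coordinate at a time

record Shift : Set where
  field up down stay : ℤ → ℤ
open Shift

act : Shift → (ℤ → ℤ) → ℤ → ℤ
act H f x = up H x * f (sucℤ (sucℤ x)) + down H x * f (pred (pred x)) + stay H x * f x

act-cong : ∀ H {f g} → (∀ x → f x ≡ g x) → ∀ x → act H f x ≡ act H g x
act-cong H e x = cong₂ _+_
  (cong₂ _+_ (cong (up H x *_) (e _)) (cong (down H x *_) (e _))) (cong (stay H x *_) (e x))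

act-+ : ∀ H f g x → act H (λ z → f z + g z) x ≡ act H f x + act H g x
act-+ H f g x = ring (up H x) (down H x) (stay H x) _ _ _ _ _ _
  where
  ring : ∀ u d s a b c a′ b′ c′ →
    u * (a + a′) + d * (b + b′) + s * (c + c′) ≡ (u * a + d * b + s * c) + (u * a′ + d * b′ + s * c′)
  ring = solve-∀

act-*ʳ : ∀ H f c x → act H (λ z → f z * c) x ≡ act H f x * c
act-*ʳ H f c x = ring (up H x) (down H x) (stay H x) _ _ _ c
  where
  ring : ∀ u d s a b c k → u * (a * k) + d * (b * k) + s * (c * k) ≡ (u * a + d * b + s * c) * k
  ring = solve-∀

act-neg : ∀ H f x → act H (λ z → - f z) x ≡ - act H f x
act-neg H f x = ring (up H x) (down H x) (stay H x) _ _ _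
  where
  ring : ∀ u d s a b c → u * (- a) + d * (- b) + s * (- c) ≡ - (u * a + d * b + s * c)
  ring = solve-∀

oneBody : Shift → Fun → Fun
oneBody H F []       = 0ℤ
oneBody H F (x ∷ xs) = act H (λ z → F (z ∷ xs)) x + oneBody H (λ v → F (x ∷ v)) xs

oneBody-cong : ∀ H {F G} → F ≗₀ G → oneBody H F ≗₀ oneBody H G
oneBody-cong H e []       = refl
oneBody-cong H e (x ∷ xs) = cong₂ _+_
  (act-cong H (λ z → e (z ∷ xs)) x) (oneBody-cong H (λ v → e (x ∷ v)) xs)

oneBody-+ : ∀ H F G → oneBody H (λ v → F v + G v) ≗₀ λ v → oneBody H F v + oneBody H G v
oneBody-+ H F G []       = refl
oneBody-+ H F G (x ∷ xs) = trans
  (cong₂ _+_ (act-+ H (λ z → F (z ∷ xs)) (λ z → G (z ∷ xs)) x)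
             (oneBody-+ H (λ v → F (x ∷ v)) (λ v → G (x ∷ v)) xs))
  (interchange (act H (λ z → F (z ∷ xs)) x) (act H (λ z → G (z ∷ xs)) x) _ _)

oneBody-neg : ∀ H F → oneBody H (λ v → - F v) ≗₀ λ v → - oneBody H F v
oneBody-neg H F []       = refl
oneBody-neg H F (x ∷ xs) = trans
  (cong₂ _+_ (act-neg H (λ z → F (z ∷ xs)) x) (oneBody-neg H (λ v → F (x ∷ v)) xs))
  (sym (ℤP.neg-distrib-+ (act H (λ z → F (z ∷ xs)) x) _))

oneBody-* : ∀ H c F → oneBody H (λ v → c * F v) ≗₀ λ v → c * oneBody H F v
oneBody-* H c F []       = sym (ℤP.*-zeroʳ c)
oneBody-* H c F (x ∷ xs) = trans
  (cong₂ _+_ (ring c (up H x) (down H x) (stay H x) _ _ _) (oneBody-* H c (λ v → F (x ∷ v)) xs))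
  (sym (ℤP.*-distribˡ-+ c _ _))
  where
  ring : ∀ k u d s a b c → u * (k * a) + d * (k * b) + s * (k * c) ≡ k * (u * a + d * b + s * c)
  ring = solve-∀

-- Comparison of the coefficients of f(x+3), f(x-3), f(x+1) and f(x-1), in this order, on the two
-- sides of H′ L = L H, where L f x = f(x+1) + f(x-1).
record Intertwines (H H′ : Shift) : Set where
  field
    up-suc    : ∀ x → up H′ x ≡ up H (sucℤ x)
    down-pred : ∀ x → down H′ x ≡ down H (pred x)
    right     : ∀ x → up H′ x + stay H′ x ≡ up H (pred x) + stay H (sucℤ x)
    left      : ∀ x → down H′ x + stay H′ x ≡ down H (sucℤ x) + stay H (pred x)

module _ {H H′ : Shift} (I : Intertwines H H′) where
  open Intertwines I

  act-hop : ∀ f x → act H′ (λ z → f (sucℤ z) + f (pred z)) x ≡ act H f (sucℤ x) + act H f (pred x)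
  act-hop f x
    rewrite pred-suc x | suc-pred x | pred-suc (sucℤ x) | suc-pred (pred x) = begin
      u′ * (a + b) + d′ * (c + d) + s′ * (b + c)
        ≡⟨ ring₁ u′ d′ s′ a b c d ⟩
      u′ * a + d′ * d + (u′ + s′) * b + (d′ + s′) * c
        ≡⟨ cong₂ _+_ (cong₂ _+_ (cong₂ _+_ (cong (_* a) (up-suc x)) (cong (_* d) (down-pred x)))
             (cong (_* b) (right x))) (cong (_* c) (left x)) ⟩
      _ ≡⟨ ring₂ (up H (sucℤ x)) (down H (pred x)) (up H (pred x)) (stay H (sucℤ x)) (down H (sucℤ x)) (stay H (pred x)) a b c d ⟩
      _ ∎
    where
    u′ = up H′ x
    d′ = down H′ x
    s′ = stay H′ x
    a = f (sucℤ (sucℤ (sucℤ x)))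
    b = f (sucℤ x)
    c = f (pred x)
    d = f (pred (pred (pred x)))
    ring₁ : ∀ u d s a b c e → u * (a + b) + d * (c + e) + s * (b + c) ≡ u * a + d * e + (u + s) * b + (d + s) * c
    ring₁ = solve-∀
    ring₂ : ∀ u d p s q r a b c e →
      u * a + d * e + (p + s) * b + (q + r) * c ≡ (u * a + q * c + s * b) + (p * b + d * e + r * c)
    ring₂ = solve-∀

  private
    hop-act : ∀ (F : Fun) xs y → act H (λ z → hop (λ v → F (z ∷ v)) xs) y ≡ hop (λ v → act H (λ z → F (z ∷ v)) y) xs
    hop-act F xs y = sym (trans (hop-+ (λ v → a v + b v) c xs)
      (cong₂ _+_ (trans (hop-+ a b xs) (cong₂ _+_ (hop-* (up H y) _ xs) (hop-* (down H y) _ xs)))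
        (hop-* (stay H y) _ xs)))
      where
      a b c : Fun
      a v = up H y * F (sucℤ (sucℤ y) ∷ v)
      b v = down H y * F (pred (pred y) ∷ v)
      c v = stay H y * F (y ∷ v)

  -- The operator meets the hop of its own coordinate through `act-hop`; with the hops of the other
  -- coordinates it commutes by linearity, as its coefficients do not depend on them.
  oneBody-hop : ∀ F → oneBody H′ (hop F) ≗₀ hop (oneBody H F)
  oneBody-hop F []       = refl
  oneBody-hop F (x ∷ xs) = begin
    act H′ (λ z → f (sucℤ z) + f (pred z)) x + oneBody H′ (λ v → hop F₊ v + hop F₋ v) xs
      ≡⟨ cong₂ _+_ (act-hop f x) (oneBody-+ H′ (hop F₊) (hop F₋) xs) ⟩
    (act H f (sucℤ x) + act H f (pred x)) + (oneBody H′ (hop F₊) xs + oneBody H′ (hop F₋) xs)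
      ≡⟨ cong₂ _+_ (cong₂ _+_ (hop-act F xs (sucℤ x)) (hop-act F xs (pred x)))
           (cong₂ _+_ (oneBody-hop F₊ xs) (oneBody-hop F₋ xs)) ⟩
    (hop A₊ xs + hop A₋ xs) + (hop (oneBody H F₊) xs + hop (oneBody H F₋) xs)
      ≡⟨ interchange (hop A₊ xs) (hop A₋ xs) _ _ ⟩
    (hop A₊ xs + hop (oneBody H F₊) xs) + (hop A₋ xs + hop (oneBody H F₋) xs)
      ≡⟨ cong₂ _+_ (sym (hop-+ A₊ (oneBody H F₊) xs)) (sym (hop-+ A₋ (oneBody H F₋) xs)) ⟩
    _ ∎
    where
    f = λ z → hop (λ v → F (z ∷ v)) xs
    F₊ = λ v → F (sucℤ x ∷ v)
    F₋ = λ v → F (pred x ∷ v)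
    A₊ = λ v → act H (λ z → F (z ∷ v)) (sucℤ x)
    A₋ = λ v → act H (λ z → F (z ∷ v)) (pred x)

-- Exterior product with a one-particle function, as a Laplace expansion: the alternating sum over
-- the coordinate handed to `f`. The empty list has none to hand over, hence 0.
wedge : (ℤ → ℤ) → Fun → Fun
wedge f G []       = 0ℤ
wedge f G (x ∷ xs) = f x * G xs - wedge f (λ v → G (x ∷ v)) xs

wedge-cong : ∀ {f g F G} → (∀ x → f x ≡ g x) → F ≗₀ G → wedge f F ≗₀ wedge g G
wedge-cong p e []       = refl
wedge-cong p e (x ∷ xs) = cong₂ _-_ (cong₂ _*_ (p x) (e xs)) (wedge-cong p (λ v → e (x ∷ v)) xs)

wedge-congʳ : ∀ f {F G} → F ≗₀ G → wedge f F ≗₀ wedge f G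
wedge-congʳ f = wedge-cong (λ _ → refl)

wedge-lin : ∀ f a F b G → wedge f (λ v → a * F v + b * G v) ≗₀ λ v → a * wedge f F v + b * wedge f G v
wedge-lin f a F b G []       = ring a b
  where
  ring : ∀ a b → 0ℤ ≡ a * 0ℤ + b * 0ℤ
  ring = solve-∀
wedge-lin f a F b G (x ∷ xs) = trans
  (cong (λ w → f x * (a * F xs + b * G xs) - w) (wedge-lin f a (λ v → F (x ∷ v)) b (λ v → G (x ∷ v)) xs))
  (ring (f x) a b (F xs) (G xs) _ _)
  where
  ring : ∀ f a b F G P Q → f * (a * F + b * G) - (a * P + b * Q) ≡ a * (f * F - P) + b * (f * G - Q)
  ring = solve-∀

wedge-linˡ : ∀ a f b g F → wedge (λ z → a * f z + b * g z) F ≗₀ λ v → a * wedge f F v + b * wedge g F v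
wedge-linˡ a f b g F []       = ring a b
  where
  ring : ∀ a b → 0ℤ ≡ a * 0ℤ + b * 0ℤ
  ring = solve-∀
wedge-linˡ a f b g F (x ∷ xs) = trans
  (cong (λ w → (a * f x + b * g x) * F xs - w) (wedge-linˡ a f b g (λ v → F (x ∷ v)) xs))
  (ring a b (f x) (g x) (F xs) _ _)
  where
  ring : ∀ a b f g F P Q → (a * f + b * g) * F - (a * P + b * Q) ≡ a * (f * F - P) + b * (g * F - Q)
  ring = solve-∀

wedge-neg : ∀ f F → wedge f (λ v → - F v) ≗₀ λ v → - wedge f F v
wedge-neg f F []       = refl
wedge-neg f F (x ∷ xs) = trans
  (cong (λ w → f x * (- F xs) - w) (wedge-neg f (λ v → F (x ∷ v)) xs)) (ring (f x) (F xs) _)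
  where
  ring : ∀ f F P → f * (- F) - (- P) ≡ - (f * F - P)
  ring = solve-∀

wedge-zero : ∀ f {F} → (∀ v → F v ≡ 0ℤ) → ∀ v → wedge f F v ≡ 0ℤ
wedge-zero f e []       = refl
wedge-zero f e (x ∷ xs) = trans
  (cong₂ _-_ (trans (cong (f x *_) (e xs)) (ℤP.*-zeroʳ (f x))) (wedge-zero f (λ v → e (x ∷ v)) xs)) refl

wedge-+ : ∀ f F G → wedge f (λ v → F v + G v) ≗₀ λ v → wedge f F v + wedge f G v
wedge-+ f F G v = trans
  (wedge-congʳ f (λ w → unit (F w) (G w)) v)
  (trans (wedge-lin f 1ℤ F 1ℤ G v) (sym (unit (wedge f F v) (wedge f G v))))
  where
  unit : ∀ a b → a + b ≡ 1ℤ * a + 1ℤ * b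
  unit = solve-∀

-- The first coordinate may go to the outer or to the inner `f`, and these two choices cancel. What
-- remains is the same expression for `G` with that coordinate fixed.
wedge-square : ∀ f G v → wedge f (wedge f G) v ≡ 0ℤ
wedge-square f G []       = refl
wedge-square f G (x ∷ xs) = begin
  f x * w - wedge f (λ v → f x * G v - wedge f (λ v → G (x ∷ v)) v) xs
    ≡⟨ cong (λ k → f x * w - k) (wedge-congʳ f (λ v → ring₁ (f x) (G v) _) xs) ⟩
  f x * w - wedge f (λ v → f x * G v + (- 1ℤ) * wedge f (λ v → G (x ∷ v)) v) xs
    ≡⟨ cong (λ k → f x * w - k) (wedge-lin f (f x) G (- 1ℤ) (wedge f (λ v → G (x ∷ v))) xs) ⟩
  f x * w - (f x * w + (- 1ℤ) * wedge f (wedge f (λ v → G (x ∷ v))) xs)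
    ≡⟨ cong (λ k → f x * w - (f x * w + (- 1ℤ) * k)) (wedge-square f (λ v → G (x ∷ v)) xs) ⟩
  f x * w - (f x * w + (- 1ℤ) * 0ℤ)
    ≡⟨ ring₂ (f x) w ⟩
  0ℤ ∎
  where
  w = wedge f G xs
  ring₁ : ∀ f g k → f * g - k ≡ f * g + (- 1ℤ) * k
  ring₁ = solve-∀
  ring₂ : ∀ f w → f * w - (f * w + (- 1ℤ) * 0ℤ) ≡ 0ℤ
  ring₂ = solve-∀

-- The Leibniz rule: the coordinate acted on is either the one handed to `f` or one left to `G`.
oneBody-wedge : ∀ H f G → oneBody H (wedge f G) ≗₀ λ v → wedge (act H f) G v + wedge f (oneBody H G) v
oneBody-wedge H f G []       = refl
oneBody-wedge H f G (x ∷ xs) = begin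
  act H (λ z → f z * G xs - W z) x + oneBody H (λ v → f x * G v - wedge f Gx v) xs
    ≡⟨ cong₂ _+_ lemma₁ lemma₂ ⟩
  (act H f x * G xs - act H W x) + (f x * oneBody H G xs - (wedge (act H f) Gx xs + wedge f (oneBody H Gx) xs))
    ≡⟨ cong (λ k → (act H f x * G xs - k) + (f x * oneBody H G xs - (wedge (act H f) Gx xs + wedge f (oneBody H Gx) xs))) actW ⟩
  _ ≡⟨ ring (act H f x * G xs) (wedge f Ax xs) (f x * oneBody H G xs) _ _ ⟩
  (act H f x * G xs - wedge (act H f) Gx xs) + (f x * oneBody H G xs - (wedge f Ax xs + wedge f (oneBody H Gx) xs))
    ≡⟨ cong (λ k → (act H f x * G xs - wedge (act H f) Gx xs) + (f x * oneBody H G xs - k))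
         (sym (wedge-+ f Ax (oneBody H Gx) xs)) ⟩
  _ ∎
  where
  Gx = λ v → G (x ∷ v)
  W = λ z → wedge f (λ v → G (z ∷ v)) xs
  Ax = λ v → act H (λ z → G (z ∷ v)) x
  ring : ∀ a b c d e → (a - b) + (c - (d + e)) ≡ (a - d) + (c - (b + e))
  ring = solve-∀
  actW : act H W x ≡ wedge f Ax xs
  actW = sym (trans (wedge-congʳ f (λ v → unit (a v + b v) (c v)) xs)
    (trans (wedge-lin f 1ℤ (λ v → a v + b v) (stay H x) (λ v → G (x ∷ v)) xs)
      (trans (cong (λ k → 1ℤ * k + stay H x * W x) (wedge-lin f (up H x) _ (down H x) _ xs))
        (sym (unit (up H x * W (sucℤ (sucℤ x)) + down H x * W (pred (pred x))) _)))))
    where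
    a b c : Fun
    a v = up H x * G (sucℤ (sucℤ x) ∷ v)
    b v = down H x * G (pred (pred x) ∷ v)
    c v = stay H x * G (x ∷ v)
    unit : ∀ a b → a + b ≡ 1ℤ * a + b
    unit = solve-∀
  lemma₁ : act H (λ z → f z * G xs - W z) x ≡ act H f x * G xs - act H W x
  lemma₁ = trans (act-+ H (λ z → f z * G xs) (λ z → - W z) x) (cong₂ _+_ (act-*ʳ H f (G xs) x) (act-neg H W x))
  lemma₂ : oneBody H (λ v → f x * G v - wedge f Gx v) xs
         ≡ f x * oneBody H G xs - (wedge (act H f) Gx xs + wedge f (oneBody H Gx) xs)
  lemma₂ = trans (oneBody-+ H (λ v → f x * G v) (λ v → - wedge f Gx v) xs)
    (cong₂ _+_ (oneBody-* H (f x) G xs) (trans (oneBody-neg H (wedge f Gx) xs) (cong -_ (oneBody-wedge H f Gx xs))))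

-- Symmetries and eigenvectors

Alternating : Fun → Set
Alternating F = ∀ as x y bs → F (as ++ x ∷ y ∷ bs) ≡ - F (as ++ y ∷ x ∷ bs)

Odd : Fun → Set
Odd F = ∀ as x bs → F (as ++ - x ∷ bs) ≡ - F (as ++ x ∷ bs)

self-neg : ∀ {a} → a ≡ - a → a ≡ 0ℤ
-- A nonzero integer and its negative have different constructors.
self-neg {+ zero} _ = refl

alternating-repeat : ∀ {F} → Alternating F → ∀ as x bs → F (as ++ x ∷ x ∷ bs) ≡ 0ℤ
alternating-repeat alt as x bs = self-neg (alt as x x bs)

odd-zero : ∀ {F} → Odd F → ∀ as bs → F (as ++ 0ℤ ∷ bs) ≡ 0ℤ
odd-zero odd as bs = self-neg (odd as 0ℤ bs)

hop-alternating : ∀ {F} → Alternating F → Alternating (hop F)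
hop-alternating {F} alt [] x y bs = trans
  (cong₂ _+_ (cong₂ _+_ (swap (sucℤ x) (sucℤ y)) (swap (sucℤ x) (pred y)))
             (cong₂ _+_ (swap (pred x) (sucℤ y)) (swap (pred x) (pred y))))
  (ring (h (sucℤ y) (sucℤ x)) (h (pred y) (sucℤ x)) (h (sucℤ y) (pred x)) (h (pred y) (pred x)))
  where
  h = λ a b → hop (λ v → F (a ∷ b ∷ v)) bs
  swap : ∀ a b → h a b ≡ - h b a
  swap a b = trans (hop-cong (λ v → alt [] a b v) bs) (hop-neg (λ v → F (b ∷ a ∷ v)) bs)
  ring : ∀ a b c d → ((- a) + (- b)) + ((- c) + (- d)) ≡ - ((a + c) + (b + d))
  ring = solve-∀
hop-alternating {F} alt (a ∷ as) x y bs = trans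
  (cong₂ _+_ (hop-alternating (λ as → alt (sucℤ a ∷ as)) as x y bs)
             (hop-alternating (λ as → alt (pred a ∷ as)) as x y bs))
  (sym (ℤP.neg-distrib-+ (hop (λ v → F (sucℤ a ∷ v)) (as ++ y ∷ x ∷ bs)) _))

suc-neg : ∀ x → sucℤ (- x) ≡ - pred x
suc-neg = ring
  where
  ring : ∀ x → (1ℤ + (- x)) ≡ - (- 1ℤ + x)
  ring = solve-∀

pred-neg : ∀ x → pred (- x) ≡ - sucℤ x
pred-neg = ring
  where
  ring : ∀ x → (- 1ℤ + (- x)) ≡ - (1ℤ + x)
  ring = solve-∀

-- Negation of a coordinate exchanges its two hops.
hop-odd : ∀ {F} → Odd F → Odd (hop F)
hop-odd {F} odd [] x bs = trans
  (cong₂ _+_ (trans (cong h (suc-neg x)) (flip (pred x))) (trans (cong h (pred-neg x)) (flip (sucℤ x))))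
  (ring (h (sucℤ x)) (h (pred x)))
  where
  h = λ a → hop (λ v → F (a ∷ v)) bs
  flip : ∀ a → h (- a) ≡ - h a
  flip a = trans (hop-cong (λ v → odd [] a v) bs) (hop-neg (λ v → F (a ∷ v)) bs)
  ring : ∀ a b → (- b) + (- a) ≡ - (a + b)
  ring = solve-∀
hop-odd {F} odd (a ∷ as) x bs = trans
  (cong₂ _+_ (hop-odd (λ as → odd (sucℤ a ∷ as)) as x bs) (hop-odd (λ as → odd (pred a ∷ as)) as x bs))
  (sym (ℤP.neg-distrib-+ (hop (λ v → F (sucℤ a ∷ v)) (as ++ x ∷ bs)) _))

oneBody-alternating : ∀ H {F} → Alternating F → Alternating (oneBody H F)
oneBody-alternating H {F} alt [] x y bs = trans
  (cong₂ _+_ (trans (act-cong H (λ z → alt [] z y bs) x) (act-neg H (λ z → F (y ∷ z ∷ bs)) x))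
    (cong₂ _+_ (trans (act-cong H (λ z → alt [] x z bs) y) (act-neg H (λ z → F (z ∷ x ∷ bs)) y))
      (trans (oneBody-cong H (λ v → alt [] x y v) bs) (oneBody-neg H (λ v → F (y ∷ x ∷ v)) bs))))
  (ring (act H (λ z → F (y ∷ z ∷ bs)) x) (act H (λ z → F (z ∷ x ∷ bs)) y) _)
  where
  ring : ∀ a b c → (- a) + ((- b) + (- c)) ≡ - (b + (a + c))
  ring = solve-∀
oneBody-alternating H {F} alt (a ∷ as) x y bs = trans
  (cong₂ _+_ (trans (act-cong H (λ z → alt (z ∷ as) x y bs) a) (act-neg H (λ z → F (z ∷ as ++ y ∷ x ∷ bs)) a))
             (oneBody-alternating H (λ as → alt (a ∷ as)) as x y bs))
  (sym (ℤP.neg-distrib-+ (act H (λ z → F (z ∷ as ++ y ∷ x ∷ bs)) a) _))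

wedge-alternating : ∀ f {G} → Alternating G → Alternating (wedge f G)
wedge-alternating f {G} alt [] x y bs = trans
  (cong (λ w → f x * G (y ∷ bs) - (f y * G (x ∷ bs) - w))
    (trans (wedge-congʳ f (λ v → alt [] x y v) bs) (wedge-neg f (λ v → G (y ∷ x ∷ v)) bs)))
  (ring (f x * G (y ∷ bs)) (f y * G (x ∷ bs)) _)
  where
  ring : ∀ a b c → a - (b - (- c)) ≡ - (b - (a - c))
  ring = solve-∀
wedge-alternating f {G} alt (a ∷ as) x y bs = trans
  (cong₂ (λ p q → f a * p - q) (alt as x y bs) (wedge-alternating f (λ as → alt (a ∷ as)) as x y bs))
  (ring (f a) (G (as ++ y ∷ x ∷ bs)) _)
  where
  ring : ∀ a b c → a * (- b) - (- c) ≡ - (a * b - c)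
  ring = solve-∀

wedge-odd : ∀ f {G} → (∀ x → f (- x) ≡ - f x) → Odd G → Odd (wedge f G)
wedge-odd f {G} f-odd odd [] x bs = trans
  (cong₂ (λ p q → p * G bs - q) (f-odd x)
    (trans (wedge-congʳ f (λ v → odd [] x v) bs) (wedge-neg f (λ v → G (x ∷ v)) bs)))
  (ring (f x) (G bs) _)
  where
  ring : ∀ a b c → (- a) * b - (- c) ≡ - (a * b - c)
  ring = solve-∀
wedge-odd f {G} f-odd odd (a ∷ as) x bs = trans
  (cong₂ (λ p q → f a * p - q) (odd as x bs) (wedge-odd f f-odd (λ as → odd (a ∷ as)) as x bs))
  (ring (f a) (G (as ++ x ∷ bs)) _)
  where
  ring : ∀ a b c → a * (- b) - (- c) ≡ - (a * b - c)
  ring = solve-∀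

-- Odd point masses and their Slater determinants

kron : ℤ → ℤ → ℤ
kron x k = if does (x ℤ.≟ k) then 1ℤ else 0ℤ

kron-sift : ∀ (c : ℤ → ℤ) x k → c x * kron x k ≡ c k * kron x k
kron-sift c x k with x ℤ.≟ k
... | yes refl = refl
... | no  _    = trans (ℤP.*-zeroʳ (c x)) (sym (ℤP.*-zeroʳ (c k)))

kron-transport : ∀ (σ τ : ℤ → ℤ) → (∀ x → τ (σ x) ≡ x) → (∀ x → σ (τ x) ≡ x) →
  ∀ x k → kron (σ x) k ≡ kron x (τ k)
kron-transport σ τ τσ στ x k with σ x ℤ.≟ k | x ℤ.≟ τ k
... | yes _  | yes _  = refl
... | no  _  | no  _  = refl
... | yes p  | no  ¬q = contradiction (trans (sym (τσ x)) (cong τ p)) ¬q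
... | no  ¬p | yes q  = contradiction (trans (cong σ q) (στ k)) ¬p

suc² pred² : ℤ → ℤ
suc² x  = sucℤ (sucℤ x)
pred² x = pred (pred x)

pred²-suc² : ∀ x → pred² (suc² x) ≡ x
pred²-suc² = ring
  where
  ring : ∀ x → (- 1ℤ + (- 1ℤ + (1ℤ + (1ℤ + x)))) ≡ x
  ring = solve-∀

suc²-pred² : ∀ x → suc² (pred² x) ≡ x
suc²-pred² = ring
  where
  ring : ∀ x → (1ℤ + (1ℤ + (- 1ℤ + (- 1ℤ + x)))) ≡ x
  ring = solve-∀

pred²-neg : ∀ x → pred² (- x) ≡ - suc² x
pred²-neg = ring
  where
  ring : ∀ x → (- 1ℤ + (- 1ℤ + (- x))) ≡ - (1ℤ + (1ℤ + x))
  ring = solve-∀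

suc²-neg : ∀ x → suc² (- x) ≡ - pred² x
suc²-neg = ring
  where
  ring : ∀ x → (1ℤ + (1ℤ + (- x))) ≡ - (- 1ℤ + (- 1ℤ + x))
  ring = solve-∀

δ : ℤ → ℤ → ℤ
δ k x = kron x k - kron x (- k)

δ-odd : ∀ k x → δ k (- x) ≡ - δ k x
δ-odd k x = trans (cong₂ _-_ (flip k) (trans (flip (- k)) (cong (kron x) (ℤP.neg-involutive k))))
  (ring (kron x k) (kron x (- k)))
  where
  flip : ∀ k → kron (- x) k ≡ kron x (- k)
  flip = kron-transport -_ -_ ℤP.neg-involutive ℤP.neg-involutive x
  ring : ∀ a b → b - a ≡ - (a - b)
  ring = solve-∀

δ-neg : ∀ k x → δ (- k) x ≡ - δ k x
δ-neg k x = trans (cong (λ j → kron x (- k) - kron x j) (ℤP.neg-involutive k)) (ring (kron x k) (kron x (- k)))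
  where
  ring : ∀ a b → b - a ≡ - (a - b)
  ring = solve-∀

-- The vacuum, on which the exterior products are built: the function of no particles with value 1.
vac : Fun
vac []      = 1ℤ
vac (_ ∷ _) = 0ℤ

-- The Slater determinant of the odd point masses at k, k + 2, ..., k + 2(n - 1).
slater : ℤ → ℕ → Fun
slater k zero    = vac
slater k (suc n) = wedge (δ k) (slater (suc² k) n)

vac-alternating : Alternating vac
vac-alternating []      x y bs = refl
vac-alternating (_ ∷ _) x y bs = refl

vac-odd : Odd vac
vac-odd []      x bs = refl
vac-odd (_ ∷ _) x bs = refl

slater-alternating : ∀ k n → Alternating (slater k n)
slater-alternating k zero    = vac-alternating
slater-alternating k (suc n) = wedge-alternating (δ k) (slater-alternating (suc² k) n)

slater-odd : ∀ k n → Odd (slater k n)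
slater-odd k zero    = vac-odd
slater-odd k (suc n) = wedge-odd (δ k) (δ-odd k) (slater-odd (suc² k) n)

record Reflecting (H : Shift) : Set where
  field
    up-neg   : ∀ x → up H (- x) ≡ down H x
    stay-neg : ∀ x → stay H (- x) ≡ stay H x

raise : ℕ → ℤ → ℤ
raise zero    k = k
raise (suc n) k = raise n (suc² k)

staySum : Shift → ℤ → ℕ → ℤ
staySum H k zero    = 0ℤ
staySum H k (suc n) = stay H k + staySum H (suc² k) n

act-zero : ∀ H x → act H (λ _ → 0ℤ) x ≡ 0ℤ
act-zero H x = ring (up H x) (down H x) (stay H x)
  where
  ring : ∀ a b c → a * 0ℤ + b * 0ℤ + c * 0ℤ ≡ 0ℤ
  ring = solve-∀

oneBody-zero : ∀ H v → oneBody H (λ _ → 0ℤ) v ≡ 0ℤ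
oneBody-zero H []      = refl
oneBody-zero H (x ∷ v) = cong₂ _+_ (act-zero H x) (oneBody-zero H v)

oneBody-vac : ∀ H v → oneBody H vac v ≡ 0ℤ
oneBody-vac H []      = refl
oneBody-vac H (x ∷ v) = cong₂ _+_ (act-zero H x) (oneBody-zero H v)

module _ {H : Shift} (R : Reflecting H) where
  open Reflecting R

  -- An operator on functions moves masses against its shifts: the `up` term puts the mass from k at
  -- k - 2, with the coefficient read there. Reflection symmetry makes the mirror image at -k move
  -- along with the same coefficients.
  act-δ : ∀ k x → act H (δ k) x ≡
    (up H (pred² k) * δ (pred² k) x + down H (suc² k) * δ (suc² k) x) + stay H k * δ k x
  act-δ k x = begin
    up H x * (kron (suc² x) k - kron (suc² x) (- k)) + down H x * (kron (pred² x) k - kron (pred² x) (- k))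
      + stay H x * (kron x k - kron x (- k))
      ≡⟨ cong₂ (λ p q → up H x * p + down H x * q + stay H x * (kron x k - kron x (- k)))
           (cong₂ _-_ (toPred k) (trans (toPred (- k)) (cong (kron x) (pred²-neg k))))
           (cong₂ _-_ (toSuc k) (trans (toSuc (- k)) (cong (kron x) (suc²-neg k)))) ⟩
    up H x * (kron x p - kron x (- s)) + down H x * (kron x s - kron x (- p))
      + stay H x * (kron x k - kron x (- k))
      ≡⟨ ring₁ (up H x) (down H x) (stay H x) (kron x p) (kron x (- p)) (kron x s) (kron x (- s)) (kron x k) (kron x (- k)) ⟩
    (up H x * kron x p - down H x * kron x (- p)) + (down H x * kron x s - up H x * kron x (- s))
      + (stay H x * kron x k - stay H x * kron x (- k))
      ≡⟨ cong₂ _+_ (cong₂ _+_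
           (cong₂ _-_ (kron-sift (up H) x p) (trans (kron-sift (down H) x (- p)) (cong (_* kron x (- p)) down-neg)))
           (cong₂ _-_ (kron-sift (down H) x s) (trans (kron-sift (up H) x (- s)) (cong (_* kron x (- s)) (up-neg s)))))
           (cong₂ _-_ (kron-sift (stay H) x k) (trans (kron-sift (stay H) x (- k)) (cong (_* kron x (- k)) (stay-neg k)))) ⟩
    (up H p * kron x p - up H p * kron x (- p)) + (down H s * kron x s - down H s * kron x (- s))
      + (stay H k * kron x k - stay H k * kron x (- k))
      ≡⟨ ring₂ (up H p) (down H s) (stay H k) (kron x p) (kron x (- p)) (kron x s) (kron x (- s)) (kron x k) (kron x (- k)) ⟩
    _ ∎
    where
    p = pred² k
    s = suc² k
    toPred : ∀ j → kron (suc² x) j ≡ kron x (pred² j)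
    toPred = kron-transport suc² pred² pred²-suc² suc²-pred² x
    toSuc : ∀ j → kron (pred² x) j ≡ kron x (suc² j)
    toSuc = kron-transport pred² suc² suc²-pred² pred²-suc² x
    down-neg : down H (- p) ≡ up H p
    down-neg = trans (sym (up-neg (- p))) (cong (up H) (ℤP.neg-involutive p))
    ring₁ : ∀ u d m a a′ b b′ c c′ →
      u * (a - b′) + d * (b - a′) + m * (c - c′) ≡ (u * a - d * a′) + (d * b - u * b′) + (m * c - m * c′)
    ring₁ = solve-∀
    ring₂ : ∀ u d m a a′ b b′ c c′ →
      (u * a - u * a′) + (d * b - d * b′) + (m * c - m * c′) ≡ (u * (a - a′) + d * (b - b′)) + m * (c - c′)
    ring₂ = solve-∀

  wedge-act-δ : ∀ k F v → wedge (act H (δ k)) F v ≡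
    (up H (pred² k) * wedge (δ (pred² k)) F v + down H (suc² k) * wedge (δ (suc² k)) F v) + stay H k * wedge (δ k) F v
  wedge-act-δ k F v = begin
    wedge (act H (δ k)) F v
      ≡⟨ wedge-cong (λ x → trans (act-δ k x) (unit (f x) _)) (λ _ → refl) v ⟩
    wedge (λ x → 1ℤ * f x + stay H k * δ k x) F v
      ≡⟨ wedge-linˡ 1ℤ f (stay H k) (δ k) F v ⟩
    1ℤ * wedge f F v + stay H k * wedge (δ k) F v
      ≡⟨ cong (λ w → 1ℤ * w + stay H k * wedge (δ k) F v)
           (wedge-linˡ (up H (pred² k)) (δ (pred² k)) (down H (suc² k)) (δ (suc² k)) F v) ⟩
    _ ≡⟨ sym (unit (up H (pred² k) * wedge (δ (pred² k)) F v + down H (suc² k) * wedge (δ (suc² k)) F v) _) ⟩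
    _ ∎
    where
    f = λ x → up H (pred² k) * δ (pred² k) x + down H (suc² k) * δ (suc² k) x
    unit : ∀ a b → a + b ≡ 1ℤ * a + b
    unit = solve-∀

  -- A one-body operator moves one of the δ's at a time; moving it onto another one gives 0, so only the outermost moves survive.
  oneBody-slater : ∀ k n → down H (raise (suc n) k) ≡ 0ℤ → ∀ v → oneBody H (slater k (suc n)) v ≡
    staySum H k (suc n) * slater k (suc n) v + up H (pred² k) * wedge (δ (pred² k)) (slater (suc² k) n) v
  oneBody-slater k zero top v = begin
    oneBody H (wedge (δ k) vac) v
      ≡⟨ oneBody-wedge H (δ k) vac v ⟩
    wedge (act H (δ k)) vac v + wedge (δ k) (oneBody H vac) v
      ≡⟨ cong₂ _+_ (wedge-act-δ k vac v) (wedge-zero (δ k) (oneBody-vac H) v) ⟩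
    (u * a + down H (suc² k) * b) + m * c + 0ℤ
      ≡⟨ cong (λ d → (u * a + d * b) + m * c + 0ℤ) top ⟩
    (u * a + 0ℤ * b) + m * c + 0ℤ
      ≡⟨ ring u a b m c ⟩
    (m + 0ℤ) * c + u * a ∎
    where
    u = up H (pred² k)
    m = stay H k
    a = wedge (δ (pred² k)) vac v
    b = wedge (δ (suc² k)) vac v
    c = wedge (δ k) vac v
    ring : ∀ u a b m c → (u * a + 0ℤ * b) + m * c + 0ℤ ≡ (m + 0ℤ) * c + u * a
    ring = solve-∀
  oneBody-slater k (suc n) top v = begin
    oneBody H (wedge (δ k) G) v
      ≡⟨ oneBody-wedge H (δ k) G v ⟩
    wedge (act H (δ k)) G v + wedge (δ k) (oneBody H G) v
      ≡⟨ cong₂ _+_ (wedge-act-δ k G v) rest ⟩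
    (u * a + d * wedge (δ (suc² k)) G v) + m * c + (s * c + u′ * 0ℤ)
      -- Moved up, the lowest mass lands on the second one.
      ≡⟨ cong (λ b → (u * a + d * b) + m * c + (s * c + u′ * 0ℤ)) (wedge-square (δ (suc² k)) G′ v) ⟩
    (u * a + d * 0ℤ) + m * c + (s * c + u′ * 0ℤ)
      ≡⟨ ring u a d m c s u′ ⟩
    (m + s) * c + u * a ∎
    where
    G′ = slater (suc² (suc² k)) n
    G = wedge (δ (suc² k)) G′
    u = up H (pred² k)
    d = down H (suc² k)
    m = stay H k
    a = wedge (δ (pred² k)) G v
    c = wedge (δ k) G v
    s = staySum H (suc² k) (suc n)
    u′ = up H (pred² (suc² k))
    -- Moved down, the second mass lands on `k`, which is already occupied.
    back : ∀ w → wedge (δ (pred² (suc² k))) G′ w ≡ wedge (δ k) G′ w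
    back = wedge-cong (λ x → cong (λ j → δ j x) (pred²-suc² k)) (λ _ → refl)
    rest : wedge (δ k) (oneBody H G) v ≡ s * c + u′ * 0ℤ
    rest = trans (wedge-congʳ (δ k) (oneBody-slater (suc² k) n top) v)
      (trans (wedge-lin (δ k) s G u′ _ v)
        (cong (λ w → s * c + u′ * w) (trans (wedge-congʳ (δ k) back v) (wedge-square (δ k) G′ v))))
    ring : ∀ u a d m c s u′ → (u * a + d * 0ℤ) + m * c + (s * c + u′ * 0ℤ) ≡ (m + s) * c + u * a
    ring = solve-∀

  -- From 1 the lowest mass can only move down to -1, which is the mirror image of 1 with the
  -- opposite sign. So the one surviving move is a multiple of the state, and `up H (- 1ℤ)` is
  -- subtracted from the eigenvalue.
  oneBody-slater₁ : ∀ n → down H (raise (suc n) 1ℤ) ≡ 0ℤ → ∀ v →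
    oneBody H (slater 1ℤ (suc n)) v ≡ (staySum H 1ℤ (suc n) - up H (- 1ℤ)) * slater 1ℤ (suc n) v
  oneBody-slater₁ n top v = trans (oneBody-slater 1ℤ n top v)
    (trans (cong (λ w → S * s + up H (- 1ℤ) * w) flip) (ring S s (up H (- 1ℤ))))
    where
    S = staySum H 1ℤ (suc n)
    s = slater 1ℤ (suc n) v
    G = slater (suc² 1ℤ) n
    -- The zero multiple pads the scalar -1 to the two-term shape of `wedge-linˡ`.
    flip : wedge (δ (- 1ℤ)) G v ≡ (- 1ℤ) * s + 0ℤ * s
    flip = trans (wedge-cong (λ x → trans (δ-neg 1ℤ x) (unit (δ 1ℤ x))) (λ _ → refl) v)
      (wedge-linˡ (- 1ℤ) (δ 1ℤ) 0ℤ (δ 1ℤ) G v)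
      where
      unit : ∀ a → - a ≡ (- 1ℤ) * a + 0ℤ * a
      unit = solve-∀
    ring : ∀ S s u → S * s + u * ((- 1ℤ) * s + 0ℤ * s) ≡ (S - u) * s
    ring = solve-∀

evolve : ℕ → Fun → Fun
evolve zero    G = G
evolve (suc t) G = hop (evolve t G)

evolve-alternating : ∀ t {G} → Alternating G → Alternating (evolve t G)
evolve-alternating zero    a = a
evolve-alternating (suc t) a = hop-alternating (evolve-alternating t a)

evolve-odd : ∀ t {G} → Odd G → Odd (evolve t G)
evolve-odd zero    a = a
evolve-odd (suc t) a = hop-odd (evolve-odd t a)

evolve-eigen : ∀ (H : ℕ → Shift) → (∀ t → Intertwines (H t) (H (suc t))) → ∀ {G} c →
  (∀ v → oneBody (H 0) G v ≡ c * G v) → ∀ t v → oneBody (H t) (evolve t G) v ≡ c * evolve t G v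
evolve-eigen H I c e zero    v = e v
evolve-eigen H I {G} c e (suc t) v = trans (oneBody-hop (I t) (evolve t G) v)
  (trans (hop-cong (evolve-eigen H I c e t) v) (hop-* c (evolve t G) v))

-- Counting with a transfer operator

record Linear {X : Set} (L : (X → ℤ) → ℤ) : Set where
  field
    cong-L : ∀ {f g} → (∀ x → f x ≡ g x) → L f ≡ L g
    zero-L : L (λ _ → 0ℤ) ≡ 0ℤ
    plus-L : ∀ f g → L (λ x → f x + g x) ≡ L f + L g
    scale-L : ∀ c f → L (λ x → c * f x) ≡ c * L f

below : (ℕ → ℤ) → ℕ → ℤ
below g zero    = 0ℤ
below g (suc h) = g h

hopℕ : (List ℕ → ℤ) → List ℕ → ℤ
hopℕ f []       = f []
hopℕ f (h ∷ hs) = hopℕ (λ v → f (suc h ∷ v)) hs + below (λ k → hopℕ (λ v → f (k ∷ v)) hs) h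

hopℕ-linear : ∀ hs → Linear (λ f → hopℕ f hs)
hopℕ-linear [] = record
  { cong-L = λ e → e []; zero-L = refl; plus-L = λ f g → refl; scale-L = λ c f → refl }
hopℕ-linear (zero ∷ hs) = record
  { cong-L = λ e → cong (_+ 0ℤ) (cong-L (λ v → e (1 ∷ v)))
  ; zero-L = cong (_+ 0ℤ) zero-L
  ; plus-L = λ f g → trans (cong (_+ 0ℤ) (plus-L (λ v → f (1 ∷ v)) (λ v → g (1 ∷ v))))
                       (interchange (hopℕ (λ v → f (1 ∷ v)) hs) _ 0ℤ 0ℤ)
  ; scale-L = λ c f → trans (cong (_+ 0ℤ) (scale-L c (λ v → f (1 ∷ v)))) (ring c (hopℕ (λ v → f (1 ∷ v)) hs)) }
  where
  open Linear (hopℕ-linear hs)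
  ring : ∀ c a → c * a + 0ℤ ≡ c * (a + 0ℤ)
  ring = solve-∀
hopℕ-linear (suc h ∷ hs) = record
  { cong-L = λ e → cong₂ _+_ (cong-L (λ v → e (2 ℕ.+ h ∷ v))) (cong-L (λ v → e (h ∷ v)))
  ; zero-L = cong₂ _+_ zero-L zero-L
  ; plus-L = λ f g → trans (cong₂ _+_ (plus-L (λ v → f (2 ℕ.+ h ∷ v)) (λ v → g (2 ℕ.+ h ∷ v)))
                                       (plus-L (λ v → f (h ∷ v)) (λ v → g (h ∷ v))))
                       (interchange (hopℕ (λ v → f (2 ℕ.+ h ∷ v)) hs) _ (hopℕ (λ v → f (h ∷ v)) hs) _)
  ; scale-L = λ c f → trans (cong₂ _+_ (scale-L c (λ v → f (2 ℕ.+ h ∷ v))) (scale-L c (λ v → f (h ∷ v))))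
                       (sym (ℤP.*-distribˡ-+ c (hopℕ (λ v → f (2 ℕ.+ h ∷ v)) hs) _)) }
  where open Linear (hopℕ-linear hs)

module _ {X : Set} {L : (X → ℤ) → ℤ} (lin : Linear L) where
  open Linear lin

  -- It serves twice: to exchange hops at the two ends of a path, and to exchange a hop with a sum
  -- over walks.
  hopℕ-commute : ∀ (F : List ℕ → X → ℤ) hs → L (λ w → hopℕ (λ v → F v w) hs) ≡ hopℕ (λ v → L (F v)) hs
  hopℕ-commute F []           = refl
  hopℕ-commute F (zero ∷ hs)  = trans (plus-L (λ w → hopℕ (λ v → F (1 ∷ v) w) hs) (λ _ → 0ℤ))
    (cong₂ _+_ (hopℕ-commute (λ v → F (1 ∷ v)) hs) zero-L)
  hopℕ-commute F (suc h ∷ hs) =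
    trans (plus-L (λ w → hopℕ (λ v → F (2 ℕ.+ h ∷ v) w) hs) (λ w → hopℕ (λ v → F (h ∷ v) w) hs))
      (cong₂ _+_ (hopℕ-commute (λ v → F (2 ℕ.+ h ∷ v)) hs) (hopℕ-commute (λ v → F (h ∷ v)) hs))

hopℕ-cong : ∀ {f g : List ℕ → ℤ} → (∀ v → f v ≡ g v) → ∀ hs → hopℕ f hs ≡ hopℕ g hs
hopℕ-cong e hs = Linear.cong-L (hopℕ-linear hs) e

hopℕ-* : ∀ c (f : List ℕ → ℤ) hs → hopℕ (λ v → c * f v) hs ≡ c * hopℕ f hs
hopℕ-* c f hs = Linear.scale-L (hopℕ-linear hs) c f

𝟙 : Bool → ℤ
𝟙 b = if b then 1ℤ else 0ℤ

kr : ℕ → ℕ → ℤ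
kr a b = 𝟙 (a ≡ᵇ b)

kr-sift : ∀ (g : ℕ → ℤ) a b → g a * kr a b ≡ g b * kr a b
kr-sift g zero    zero    = refl
kr-sift g zero    (suc b) = trans (ℤP.*-zeroʳ (g 0)) (sym (ℤP.*-zeroʳ (g (suc b))))
kr-sift g (suc a) zero    = trans (ℤP.*-zeroʳ (g (suc a))) (sym (ℤP.*-zeroʳ (g 0)))
kr-sift g (suc a) (suc b) = kr-sift (λ k → g (suc k)) a b

same : List ℕ → List ℕ → ℤ
same []       []       = 1ℤ
same (a ∷ as) (b ∷ bs) = kr a b * same as bs
same _        _        = 0ℤ

same-sift : ∀ (g : List ℕ → ℤ) x e → g x * same x e ≡ g e * same x e
same-sift g []       []       = refl
same-sift g []       (b ∷ e)  = trans (ℤP.*-zeroʳ (g [])) (sym (ℤP.*-zeroʳ (g (b ∷ e))))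
same-sift g (a ∷ x)  []       = trans (ℤP.*-zeroʳ (g (a ∷ x))) (sym (ℤP.*-zeroʳ (g [])))
same-sift g (a ∷ x)  (b ∷ e)  = begin
  g (a ∷ x) * (kr a b * same x e)  ≡⟨ left (g (a ∷ x)) (kr a b) (same x e) ⟩
  g (a ∷ x) * kr a b * same x e    ≡⟨ cong (_* same x e) (kr-sift (λ k → g (k ∷ x)) a b) ⟩
  g (b ∷ x) * kr a b * same x e    ≡⟨ swap (g (b ∷ x)) (kr a b) (same x e) ⟩
  g (b ∷ x) * same x e * kr a b    ≡⟨ cong (_* kr a b) (same-sift (λ v → g (b ∷ v)) x e) ⟩
  g (b ∷ e) * same x e * kr a b    ≡⟨ sym (swap (g (b ∷ e)) (kr a b) (same x e)) ⟩
  g (b ∷ e) * kr a b * same x e    ≡⟨ sym (left (g (b ∷ e)) (kr a b) (same x e)) ⟩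
  g (b ∷ e) * (kr a b * same x e)  ∎
  where
  left : ∀ a b c → a * (b * c) ≡ a * b * c
  left = solve-∀
  swap : ∀ a b c → a * b * c ≡ a * c * b
  swap = solve-∀

kr-adjacent : ∀ a b → kr (suc a) b + below (λ k → kr k b) a ≡ kr a (suc b) + below (λ k → kr a k) b
kr-adjacent zero    zero    = refl
kr-adjacent zero    (suc b) = ℤP.+-comm (kr 0 b) 0ℤ
kr-adjacent (suc a) zero    = ℤP.+-comm 0ℤ (kr a 0)
kr-adjacent (suc a) (suc b) = ℤP.+-comm (kr (suc a) b) (kr a (suc b))

below-*ʳ : ∀ g c h → below (λ k → g k * c) h ≡ below g h * c
below-*ʳ g c zero    = refl
below-*ʳ g c (suc h) = refl

below-cong : ∀ {f g} → (∀ k → f k ≡ g k) → ∀ h → below f h ≡ below g h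
below-cong e zero    = refl
below-cong e (suc h) = e h

hopℕ-same : ∀ x e → hopℕ (λ v → same v e) x ≡ hopℕ (λ w → same x w) e
hopℕ-same []      []      = refl
hopℕ-same []      (b ∷ e) = sym (Linear.zero-L (hopℕ-linear (b ∷ e)))
hopℕ-same (a ∷ x) []      = Linear.zero-L (hopℕ-linear (a ∷ x))
hopℕ-same (a ∷ x) (b ∷ e) = begin
  hopℕ (λ v → kr (suc a) b * same v e) x + below (λ k → hopℕ (λ v → kr k b * same v e) x) a
    ≡⟨ cong₂ _+_ (X.scale-L (kr (suc a) b) (λ v → same v e))
         (trans (below-cong (λ k → X.scale-L (kr k b) (λ v → same v e)) a) (below-*ʳ (λ k → kr k b) _ a)) ⟩
  kr (suc a) b * s + below (λ k → kr k b) a * s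
    ≡⟨ sym (ℤP.*-distribʳ-+ s (kr (suc a) b) _) ⟩
  (kr (suc a) b + below (λ k → kr k b) a) * s
    ≡⟨ cong₂ _*_ (kr-adjacent a b) (hopℕ-same x e) ⟩
  (kr a (suc b) + below (λ k → kr a k) b) * s′
    ≡⟨ ℤP.*-distribʳ-+ s′ (kr a (suc b)) _ ⟩
  kr a (suc b) * s′ + below (λ k → kr a k) b * s′
    ≡⟨ sym (cong₂ _+_ (E.scale-L (kr a (suc b)) (λ v → same x v))
         (trans (below-cong (λ k → E.scale-L (kr a k) (λ v → same x v)) b) (below-*ʳ (λ k → kr a k) _ b))) ⟩
  _ ∎
  where
  module X = Linear (hopℕ-linear x)
  module E = Linear (hopℕ-linear e)
  s = hopℕ (λ v → same v e) x
  s′ = hopℕ (λ w → same x w) e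

module Transfer (χ κ : List ℕ → ℤ) where

  -- Weighted number of paths of configurations: each of the t + 1 configurations, both ends
  -- included, contributes a factor `χ`.
  count : ℕ → List ℕ → List ℕ → ℤ
  count zero    x e = χ x * same x e
  count (suc t) x e = χ x * hopℕ (λ v → count t v e) x

  -- The same paths, each multiplied by the sum of `κ` over its t + 1 configurations.
  marked : ℕ → List ℕ → List ℕ → ℤ
  marked zero    x e = κ x * count 0 x e
  marked (suc t) x e = κ x * count (suc t) x e + χ x * hopℕ (λ v → marked t v e) x

  hopℕ-swap : ∀ (F : List ℕ → List ℕ → ℤ) x e →
    hopℕ (λ v → hopℕ (F v) e) x ≡ hopℕ (λ w → hopℕ (λ v → F v w) x) e
  hopℕ-swap F x e = sym (hopℕ-commute (hopℕ-linear e) F x)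

  private
    scale₂ : ∀ c d (F : List ℕ → List ℕ → ℤ) x e →
      c * hopℕ (λ v → d * hopℕ (F v) e) x ≡ d * hopℕ (λ w → c * hopℕ (λ v → F v w) x) e
    scale₂ c d F x e = begin
      c * hopℕ (λ v → d * hopℕ (F v) e) x  ≡⟨ cong (c *_) (hopℕ-* d (λ v → hopℕ (F v) e) x) ⟩
      c * (d * hopℕ (λ v → hopℕ (F v) e) x) ≡⟨ cong (λ h → c * (d * h)) (hopℕ-swap F x e) ⟩
      c * (d * hopℕ (λ w → hopℕ (λ v → F v w) x) e) ≡⟨ ring c d _ ⟩
      d * (c * hopℕ (λ w → hopℕ (λ v → F v w) x) e) ≡⟨ cong (d *_) (sym (hopℕ-* c (λ w → hopℕ (λ v → F v w) x) e)) ⟩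
      d * hopℕ (λ w → c * hopℕ (λ v → F v w) x) e ∎
      where
      ring : ∀ c d h → c * (d * h) ≡ d * (c * h)
      ring = solve-∀

  -- The definition strips the first step, as the encoding of walks by lists does, whereas the wave
  -- evolves at the end point. By the symmetry in `hopℕ-same` the last step can be stripped instead.
  count-last : ∀ t x e → count (suc t) x e ≡ χ e * hopℕ (count t x) e
  count-last zero x e = begin
    χ x * hopℕ (λ v → χ v * same v e) x
      ≡⟨ cong (χ x *_) (hopℕ-cong (λ v → same-sift χ v e) x) ⟩
    χ x * hopℕ (λ v → χ e * same v e) x
      ≡⟨ cong (χ x *_) (trans (hopℕ-* (χ e) (λ v → same v e) x) (cong (χ e *_) (hopℕ-same x e))) ⟩
    χ x * (χ e * hopℕ (same x) e)
      ≡⟨ ring (χ x) (χ e) _ ⟩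
    χ e * (χ x * hopℕ (same x) e)
      ≡⟨ cong (χ e *_) (sym (hopℕ-* (χ x) (same x) e)) ⟩
    χ e * hopℕ (λ w → χ x * same x w) e ∎
    where
    ring : ∀ c d h → c * (d * h) ≡ d * (c * h)
    ring = solve-∀
  count-last (suc t) x e = trans
    (cong (χ x *_) (hopℕ-cong (λ v → count-last t v e) x)) (scale₂ (χ x) (χ e) (count t) x e)

  marked-last₀ : ∀ x e → marked 0 x e ≡ κ e * count 0 x e
  marked-last₀ x e = same-sift′ (κ x) (κ e) (χ x) (same-sift κ x e)
    where
    same-sift′ : ∀ a b c {s} → a * s ≡ b * s → a * (c * s) ≡ b * (c * s)
    same-sift′ a b c {s} p = trans (swap a c s) (trans (cong (c *_) p) (sym (swap b c s)))
      where
      swap : ∀ a c s → a * (c * s) ≡ c * (a * s)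
      swap = solve-∀

  marked-last : ∀ t x e → marked (suc t) x e ≡ κ e * count (suc t) x e + χ e * hopℕ (marked t x) e
  marked-last zero x e = begin
    κ x * k + χ x * hopℕ (λ v → marked 0 v e) x
      ≡⟨ cong (λ h → κ x * k + χ x * h) (trans (hopℕ-cong (λ v → marked-last₀ v e) x) (hopℕ-* (κ e) (λ v → count 0 v e) x)) ⟩
    κ x * k + χ x * (κ e * hopℕ (λ v → count 0 v e) x)
      ≡⟨ ring (κ x) k (χ x) (κ e) _ ⟩
    κ e * (χ x * hopℕ (λ v → count 0 v e) x) + κ x * k
      ≡⟨ cong (λ h → κ e * k + κ x * h) (count-last 0 x e) ⟩
    κ e * k + κ x * (χ e * hopℕ (count 0 x) e)
      ≡⟨ cong (λ h → κ e * k + h) (swap (κ x) (χ e) _) ⟩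
    κ e * k + χ e * (κ x * hopℕ (count 0 x) e)
      ≡⟨ cong (λ h → κ e * k + χ e * h) (sym (hopℕ-* (κ x) (count 0 x) e)) ⟩
    κ e * k + χ e * hopℕ (marked 0 x) e ∎
    where
    k = count 1 x e
    ring : ∀ a k c b h → a * k + c * (b * h) ≡ b * (c * h) + a * k
    ring = solve-∀
    swap : ∀ a c s → a * (c * s) ≡ c * (a * s)
    swap = solve-∀
  marked-last (suc t) x e = begin
    κ x * k + χ x * hopℕ (λ v → marked (suc t) v e) x
      ≡⟨ cong (λ h → κ x * k + χ x * h) (trans (hopℕ-cong (λ v → marked-last t v e) x)
           (trans (Linear.plus-L (hopℕ-linear x) (λ v → κ e * count (suc t) v e) (λ v → χ e * hopℕ (marked t v) e))
             (cong (_+ hopℕ (λ v → χ e * hopℕ (marked t v) e) x) (hopℕ-* (κ e) (λ v → count (suc t) v e) x)))) ⟩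
    κ x * k + χ x * (κ e * h₁ + h₂)
      ≡⟨ ring (κ x) k (χ x) (κ e) h₁ h₂ ⟩
    κ e * (χ x * h₁) + (κ x * k + χ x * h₂)
      ≡⟨ cong₂ (λ a b → κ e * k + (κ x * a + b)) (count-last (suc t) x e) (scale₂ (χ x) (χ e) (marked t) x e) ⟩
    κ e * k + (κ x * (χ e * h₃) + χ e * h₄)
      ≡⟨ cong (λ h → κ e * k + h) (ring₂ (κ x) (χ e) h₃ h₄) ⟩
    κ e * k + χ e * (κ x * h₃ + h₄)
      ≡⟨ cong (λ h → κ e * k + χ e * h) (sym (trans
           (Linear.plus-L (hopℕ-linear e) (λ w → κ x * count (suc t) x w) (λ w → χ x * hopℕ (λ v → marked t v w) x))
           (cong (_+ h₄) (hopℕ-* (κ x) (count (suc t) x) e)))) ⟩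
    _ ∎
    where
    k = count (suc (suc t)) x e
    h₁ = hopℕ (λ v → count (suc t) v e) x
    h₂ = hopℕ (λ v → χ e * hopℕ (marked t v) e) x
    h₃ = hopℕ (count (suc t) x) e
    h₄ = hopℕ (λ w → χ x * hopℕ (λ v → marked t v w) x) e
    ring : ∀ a k c b h i → a * k + c * (b * h + i) ≡ b * (c * h) + (a * k + c * i)
    ring = solve-∀
    ring₂ : ∀ a c h i → a * (c * h) + c * i ≡ c * (a * h + i)
    ring₂ = solve-∀

-- The chamber and the reflection principle

distinct : List ℕ → Bool
distinct []       = true
distinct (a ∷ as) = and (map (λ b → not (a ≡ᵇ b)) as) ∧ distinct as

χ κ : List ℕ → ℤ
χ h = 𝟙 (distinct h)
κ h = + length (filter (ℕ._≟ 0) h)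

open Transfer χ κ

-- The consecutive differences of a ∷ hs are even and at least 2j; by evenness, walkers meet before they cross.
data Gaps (j a : ℕ) : List ℕ → Set where
  []   : Gaps j a []
  cons : ∀ k {h hs} → h ≡ (j ℕ.+ k) ℕ.+ (j ℕ.+ k) ℕ.+ a → Gaps j h hs → Gaps j a (h ∷ hs)

Chamber : List ℕ → Set
Chamber []       = ⊤
Chamber (a ∷ hs) = Gaps 1 a hs

Closed : List ℕ → Set
Closed []       = ⊤
Closed (a ∷ hs) = Gaps 0 a hs

data Neighbour : List ℕ → List ℕ → Set where
  []   : Neighbour [] []
  rise : ∀ {h hs vs} → Neighbour hs vs → Neighbour (h ∷ hs) (suc h ∷ vs)
  fall : ∀ {h hs vs} → Neighbour hs vs → Neighbour (suc h ∷ hs) (h ∷ vs)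

hopℕ-cong-neighbour : ∀ {f g : List ℕ → ℤ} hs → (∀ {v} → Neighbour hs v → f v ≡ g v) → hopℕ f hs ≡ hopℕ g hs
hopℕ-cong-neighbour []           e = e []
hopℕ-cong-neighbour (zero ∷ hs)  e = cong (_+ 0ℤ) (hopℕ-cong-neighbour hs (λ n → e (rise n)))
hopℕ-cong-neighbour (suc h ∷ hs) e =
  cong₂ _+_ (hopℕ-cong-neighbour hs (λ n → e (rise n))) (hopℕ-cong-neighbour hs (λ n → e (fall n)))

-- A joint step changes every gap by -2, 0 or 2, so the half-gap 1 + k becomes k, 1 + k or 2 + k.
gaps-neighbour : ∀ {a b hs vs} → Gaps 1 a hs → Neighbour (a ∷ hs) (b ∷ vs) → Gaps 0 b vs
gaps-neighbour []            (rise [])   = []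
gaps-neighbour []            (fall []) = []
gaps-neighbour {a} (cons k e g) (rise (rise n)) =
  cons (suc k) (trans (cong suc e) (ring k a)) (gaps-neighbour g (rise n))
  where
  ring : ∀ k a → suc ((1 ℕ.+ k) ℕ.+ (1 ℕ.+ k) ℕ.+ a) ≡ (1 ℕ.+ k) ℕ.+ (1 ℕ.+ k) ℕ.+ suc a
  ring = ℕSolver.solve-∀
gaps-neighbour {a} (cons k e g) (rise (fall n)) =
  cons k (ℕP.suc-injective (trans e (ring k a))) (gaps-neighbour g (fall n))
  where
  ring : ∀ k a → (1 ℕ.+ k) ℕ.+ (1 ℕ.+ k) ℕ.+ a ≡ suc (k ℕ.+ k ℕ.+ suc a)
  ring = ℕSolver.solve-∀
gaps-neighbour {suc a} (cons k e g) (fall (rise n)) =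
  cons (suc (suc k)) (trans (cong suc e) (ring k a)) (gaps-neighbour g (rise n))
  where
  ring : ∀ k a → suc ((1 ℕ.+ k) ℕ.+ (1 ℕ.+ k) ℕ.+ suc a) ≡ (2 ℕ.+ k) ℕ.+ (2 ℕ.+ k) ℕ.+ a
  ring = ℕSolver.solve-∀
gaps-neighbour {suc a} (cons k e g) (fall (fall n)) =
  cons (suc k) (ℕP.suc-injective (trans e (ring k a))) (gaps-neighbour g (fall n))
  where
  ring : ∀ k a → (1 ℕ.+ k) ℕ.+ (1 ℕ.+ k) ℕ.+ suc a ≡ suc ((1 ℕ.+ k) ℕ.+ (1 ℕ.+ k) ℕ.+ a)
  ring = ℕSolver.solve-∀

chamber-neighbour : ∀ {h v} → Chamber h → Neighbour h v → Closed v
chamber-neighbour c []       = tt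
chamber-neighbour c (rise n)   = gaps-neighbour c (rise n)
chamber-neighbour c (fall n) = gaps-neighbour c (fall n)

data Repeat : List ℕ → Set where
  here  : ∀ {a as} → Repeat (a ∷ a ∷ as)
  there : ∀ {a as} → Repeat as → Repeat (a ∷ as)

gaps-split : ∀ {a hs} → Gaps 0 a hs → Gaps 1 a hs ⊎ Repeat (a ∷ hs)
gaps-split []                 = inj₁ []
gaps-split (cons zero refl g) = inj₂ here
gaps-split (cons (suc k) e g) with gaps-split g
... | inj₁ s = inj₁ (cons k e s)
... | inj₂ r = inj₂ (there r)

closed-split : ∀ v → Closed v → Chamber v ⊎ Repeat v
closed-split []      _ = inj₁ tt
closed-split (a ∷ v) g = gaps-split g

gaps-above : ∀ {a b hs} → b ≤ a → Gaps 1 a hs → All (b <_) hs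
gaps-above b≤a []            = []
gaps-above {a} {b} b≤a (cons k {h} e g) = b<h ∷ gaps-above (ℕP.<⇒≤ b<h) g
  where
  b<h : b < h
  b<h = ℕP.≤-trans (s≤s b≤a) (ℕP.≤-trans (ℕP.m≤n+m (suc a) (suc (k ℕ.+ k)))
          (ℕP.≤-reflexive (trans (ring k a) (sym e))))
    where
    ring : ∀ k a → suc (k ℕ.+ k) ℕ.+ suc a ≡ (1 ℕ.+ k) ℕ.+ (1 ℕ.+ k) ℕ.+ a
    ring = ℕSolver.solve-∀

≡ᵇ-refl : ∀ a → (a ≡ᵇ a) ≡ true
≡ᵇ-refl zero    = refl
≡ᵇ-refl (suc a) = ≡ᵇ-refl a

<⇒≢ᵇ : ∀ {a b} → a < b → (a ≡ᵇ b) ≡ false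
<⇒≢ᵇ {zero}  (s≤s _) = refl
<⇒≢ᵇ {suc a} (s≤s p) = <⇒≢ᵇ p

>⇒≢ᵇ : ∀ {a b} → b < a → (a ≡ᵇ b) ≡ false
>⇒≢ᵇ {b = zero}  (s≤s _) = refl
>⇒≢ᵇ {b = suc b} (s≤s p) = >⇒≢ᵇ p

distinct-above : ∀ {a hs} → All (a <_) hs → and (map (λ b → not (a ≡ᵇ b)) hs) ≡ true
distinct-above []       = refl
distinct-above (p ∷ ps) = cong₂ (λ x y → not x ∧ y) (<⇒≢ᵇ p) (distinct-above ps)

gaps-distinct : ∀ {a hs} → Gaps 1 a hs → distinct (a ∷ hs) ≡ true
gaps-distinct []             = refl
gaps-distinct s@(cons k e g) = cong₂ _∧_ (distinct-above (gaps-above ℕP.≤-refl s)) (gaps-distinct g)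

chamber-χ : ∀ h → Chamber h → χ h ≡ 1ℤ
chamber-χ []      _ = refl
chamber-χ (a ∷ h) g = cong 𝟙 (gaps-distinct g)

repeat-distinct : ∀ {h} → Repeat h → distinct h ≡ false
repeat-distinct (here {a} {as}) rewrite ≡ᵇ-refl a = refl
repeat-distinct (there {a} {as} r) rewrite repeat-distinct r = ∧-zeroʳ (and (map (λ b → not (a ≡ᵇ b)) as))

repeat-χ : ∀ {h} → Repeat h → χ h ≡ 0ℤ
repeat-χ r = cong 𝟙 (repeat-distinct r)

ι : ℕ → ℤ
ι h = + suc h

repeat-alternating : ∀ {F} → Alternating F → ∀ {h} → Repeat h → F (map ι h) ≡ 0ℤ
repeat-alternating {F} alt (here {a} {as}) = alternating-repeat {F} alt [] (ι a) (map ι as)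
repeat-alternating {F} alt (there {a} r)   = repeat-alternating {λ v → F (ι a ∷ v)} (λ as → alt (ι a ∷ as)) r

hop-vanish : ∀ {F} → (∀ v → F v ≡ 0ℤ) → ∀ v → hop F v ≡ 0ℤ
hop-vanish e []      = e []
hop-vanish e (x ∷ v) = cong₂ _+_ (hop-vanish (λ w → e (sucℤ x ∷ w)) v) (hop-vanish (λ w → e (pred x ∷ w)) v)

-- The extra branch of the free hop, a fall from height 0, lands on coordinate 0, where an odd
-- function vanishes.
hop-ι : ∀ F → Odd F → ∀ h → hop F (map ι h) ≡ hopℕ (λ v → F (map ι v)) h
hop-ι F odd []          = refl
hop-ι F odd (zero ∷ h)  = cong₂ _+_ (hop-ι (λ v → F (ι 1 ∷ v)) (λ as → odd (ι 1 ∷ as)) h)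
  (hop-vanish (λ v → odd-zero {F} odd [] v) (map ι h))
hop-ι F odd (suc a ∷ h) = cong₂ _+_ (hop-ι (λ v → F (ι (2 ℕ.+ a) ∷ v)) (λ as → odd (ι (2 ℕ.+ a) ∷ as)) h)
  (hop-ι (λ v → F (ι a ∷ v)) (λ as → odd (ι a ∷ as)) h)

-- From positive heights no hop reaches coordinate 0. This version serves `touch`, whose values at 0
-- do not vanish in general.
hop-ι-positive : ∀ F {h} → All (0 <_) h → hop F (map ι h) ≡ hopℕ (λ v → F (map ι v)) h
hop-ι-positive F []              = refl
hop-ι-positive F {suc a ∷ h} (_ ∷ ps) = cong₂ _+_
  (hop-ι-positive (λ v → F (ι (suc (suc a)) ∷ v)) ps) (hop-ι-positive (λ v → F (ι a ∷ v)) ps)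

-- The induction step of the reflection principle, shared by counts and contacts: a step from the
-- chamber ends in the chamber or in a collision, and in a collision both functions vanish.
hopℕ-chamber : ∀ F f → Alternating F → (∀ v → Chamber v → F (map ι v) ≡ f v) → (∀ v → Repeat v → f v ≡ 0ℤ) →
  ∀ h → Chamber h → hopℕ (λ v → F (map ι v)) h ≡ hopℕ f h
hopℕ-chamber F f alt agree vanish h c = hopℕ-cong-neighbour h step
  where
  step : ∀ {v} → Neighbour h v → F (map ι v) ≡ f v
  step {v} n with closed-split v (chamber-neighbour c n)
  ... | inj₁ s = agree v s
  ... | inj₂ r = trans (repeat-alternating {F} alt r) (sym (vanish v r))

flat : ℕ → ℕ → List ℕ
flat a zero    = []
flat a (suc n) = a ∷ flat (2 ℕ.+ a) n

-- The spacing contained in `Gaps 1`, without evenness; this is what makes the initial determinant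
-- triangular.
data Above (a : ℕ) : List ℕ → Set where
  []  : Above a []
  _∷_ : ∀ {b hs} → a ≤ b → Above (2 ℕ.+ b) hs → Above a (b ∷ hs)

gaps-Above : ∀ {a hs} → Gaps 1 a hs → Above (2 ℕ.+ a) hs
gaps-Above []           = []
gaps-Above {a} (cons k {h} e g) = le ∷ gaps-Above g
  where
  ring : ∀ k a → (k ℕ.+ k) ℕ.+ (2 ℕ.+ a) ≡ (1 ℕ.+ k) ℕ.+ (1 ℕ.+ k) ℕ.+ a
  ring = ℕSolver.solve-∀
  le : 2 ℕ.+ a ≤ h
  le = ℕP.≤-trans (ℕP.m≤n+m (2 ℕ.+ a) (k ℕ.+ k)) (ℕP.≤-reflexive (trans (ring k a) (sym e)))

chamber-Above : ∀ h → Chamber h → Above 0 h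
chamber-Above []      _ = []
chamber-Above (a ∷ h) g = z≤n ∷ gaps-Above g

Above-All : ∀ {a hs} → Above a hs → All (a ≤_) hs
Above-All []       = []
Above-All (p ∷ ps) = p ∷ All.map (λ q → ℕP.≤-trans p (ℕP.≤-trans (ℕP.m≤n+m _ 2) q)) (Above-All ps)

δ-ι : ∀ a b → δ (ι a) (ι b) ≡ kr b a
δ-ι a b = ℤP.+-identityʳ (kr b a)

kr-< : ∀ {a b} → a < b → kr b a ≡ 0ℤ
kr-< p = cong 𝟙 (>⇒≢ᵇ p)

wedge-vanish : ∀ f G {hs} → All (λ h → f (ι h) ≡ 0ℤ) hs → wedge f G (map ι hs) ≡ 0ℤ
wedge-vanish f G []                     = refl
wedge-vanish f G {h ∷ hs} (p ∷ ps) = cong₂ (λ x y → x * G (map ι hs) - y) p (wedge-vanish f (λ v → G (ι h ∷ v)) ps)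

δ-above : ∀ {a b hs} → a ≤ b → Above (2 ℕ.+ b) hs → All (λ h → δ (ι a) (ι h) ≡ 0ℤ) hs
δ-above {a} a≤b ab = All.map
  (λ {h} q → trans (δ-ι a h) (kr-< (ℕP.≤-trans (s≤s a≤b) (ℕP.≤-trans (ℕP.n≤1+n _) q)))) (Above-All ab)

wedge-δ : ∀ {a b hs} G → a ≤ b → Above (2 ℕ.+ b) hs →
  wedge (δ (ι a)) G (map ι (b ∷ hs)) ≡ kr b a * G (map ι hs)
wedge-δ {a} {b} {hs} G a≤b ab = trans
  (cong₂ (λ x y → x * G (map ι hs) - y) (δ-ι a b) (wedge-vanish (δ (ι a)) (λ v → G (ι b ∷ v)) (δ-above a≤b ab)))
  (ring (kr b a * G (map ι hs)))
  where
  ring : ∀ a → a - 0ℤ ≡ a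
  ring = solve-∀

-- The determinant is triangular here: every coordinate beyond the lowest exceeds `a`, so the mass
-- at `a` can be met by the lowest one only, and the induction passes to the remaining coordinates.
slater-flat : ∀ a n hs → Above a hs → slater (ι a) n (map ι hs) ≡ same (flat a n) hs
slater-flat a zero    []       _ = refl
slater-flat a zero    (_ ∷ _)  _ = refl
slater-flat a (suc n) []       _ = refl
slater-flat a (suc n) (b ∷ hs) (a≤b ∷ ab) = trans (wedge-δ (slater (ι (2 ℕ.+ a)) n) a≤b ab) rest
  where
  rest : kr b a * slater (ι (2 ℕ.+ a)) n (map ι hs) ≡ kr a b * same (flat (2 ℕ.+ a) n) hs
  rest with a ℕ.≟ b
  ... | yes refl = cong (kr a a *_) (slater-flat (2 ℕ.+ a) n hs ab)
  ... | no a≢b  = trans (cong (_* slater (ι (2 ℕ.+ a)) n (map ι hs)) (kr-< a<b))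
                        (sym (cong (_* same (flat (2 ℕ.+ a) n) hs) (cong 𝟙 (<⇒≢ᵇ a<b))))
    where a<b = ℕP.≤∧≢⇒< a≤b a≢b

gaps-flat : ∀ a n → Gaps 1 a (flat (2 ℕ.+ a) n)
gaps-flat a zero    = []
gaps-flat a (suc n) = cons 0 refl (gaps-flat (2 ℕ.+ a) n)

chamber-flat : ∀ a n → Chamber (flat a n)
chamber-flat a zero    = tt
chamber-flat a (suc n) = gaps-flat a n

count-repeat : ∀ t x e → Repeat e → count t x e ≡ 0ℤ
count-repeat zero    x e r = trans (same-sift χ x e) (trans (cong (_* same x e) (repeat-χ r)) (ℤP.*-zeroˡ (same x e)))
count-repeat (suc t) x e r = trans (count-last t x e)
  (trans (cong (_* hopℕ (count t x) e) (repeat-χ r)) (ℤP.*-zeroˡ (hopℕ (count t x) e)))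

count-chamber : ∀ t x e → Chamber e → count (suc t) x e ≡ hopℕ (count t x) e
count-chamber t x e c = trans (count-last t x e)
  (trans (cong (_* hopℕ (count t x) e) (chamber-χ e c)) (ℤP.*-identityˡ (hopℕ (count t x) e)))

κ-positive : ∀ {hs} → All (0 <_) hs → κ hs ≡ 0ℤ
κ-positive []                  = refl
κ-positive {suc h ∷ hs} (_ ∷ ps) = κ-positive ps

κ-bottom : ∀ {hs} → All (0 <_) hs → κ (0 ∷ hs) ≡ 1ℤ
κ-bottom {hs} ps = cong (λ a → 1ℤ + a) (κ-positive ps)

marked-repeat : ∀ t x e → Repeat e → marked t x e ≡ 0ℤ
marked-repeat zero    x e r = trans (cong (κ x *_) (count-repeat 0 x e r)) (ℤP.*-zeroʳ (κ x))
marked-repeat (suc t) x e r = trans (marked-last t x e)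
  (trans (cong₂ (λ a b → κ e * a + b * hopℕ (marked t x) e) (count-repeat (suc t) x e r) (repeat-χ r))
    (ring (κ e) (hopℕ (marked t x) e)))
  where
  ring : ∀ a b → a * 0ℤ + 0ℤ * b ≡ 0ℤ
  ring = solve-∀

marked-chamber : ∀ t x e → Chamber e → marked (suc t) x e ≡ κ e * count (suc t) x e + hopℕ (marked t x) e
marked-chamber t x e c = trans (marked-last t x e)
  (trans (cong (λ b → κ e * count (suc t) x e + b * hopℕ (marked t x) e) (chamber-χ e c))
    (cong (λ b → κ e * count (suc t) x e + b) (ℤP.*-identityˡ (hopℕ (marked t x) e))))

module _ (n : ℕ) where

  ρ : List ℕ
  ρ = flat 0 n

  wave : ℕ → Fun
  wave t = evolve t (slater 1ℤ n)

  wave-alternating : ∀ t → Alternating (wave t)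
  wave-alternating t = evolve-alternating t (slater-alternating 1ℤ n)

  wave-odd : ∀ t → Odd (wave t)
  wave-odd t = evolve-odd t (slater-odd 1ℤ n)

  wave₀ : ∀ h → Chamber h → wave 0 (map ι h) ≡ count 0 ρ h
  wave₀ h c = trans (slater-flat 0 n h (chamber-Above h c))
    (sym (trans (cong (_* same ρ h) (chamber-χ ρ (chamber-flat 0 n))) (ℤP.*-identityˡ (same ρ h))))

  wave-count : ∀ t h → Chamber h → wave t (map ι h) ≡ count t ρ h
  wave-count zero    h c = wave₀ h c
  wave-count (suc t) h c = begin
    hop (wave t) (map ι h)                ≡⟨ hop-ι (wave t) (wave-odd t) h ⟩
    hopℕ (λ v → wave t (map ι v)) h       ≡⟨ hopℕ-chamber (wave t) (count t ρ) (wave-alternating t) (wave-count t) (λ v → count-repeat t ρ v) h c ⟩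
    hopℕ (count t ρ) h                    ≡⟨ sym (count-chamber t ρ h c) ⟩
    count (suc t) ρ h                     ∎

-- Contacts as raised end points

raising : Shift
raising = record { up = λ _ → 1ℤ; down = λ _ → 0ℤ; stay = λ _ → 0ℤ }

raising-intertwines : Intertwines raising raising
raising-intertwines = record
  { up-suc = λ _ → refl; down-pred = λ _ → refl; right = λ _ → refl; left = λ _ → refl }

act-raising : ∀ f x → act raising f x ≡ f (suc² x)
act-raising f x = ring (f (suc² x)) (f (pred² x)) (f x)
  where
  ring : ∀ a b c → 1ℤ * a + 0ℤ * b + 0ℤ * c ≡ a
  ring = solve-∀

-- The mass at `a` would have to be met at a height h + 2 with h ≥ a. If instead the raised
-- coordinate belongs to a later mass, the same argument applies to that mass. At time 0 the
-- correction to the count thus vanishes.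
raising-slater : ∀ a n hs → Above a hs → oneBody raising (slater (ι a) n) (map ι hs) ≡ 0ℤ
raising-slater a zero    hs ab = oneBody-vac raising (map ι hs)
raising-slater a (suc n) hs ab = trans (oneBody-wedge raising (δ (ι a)) G (map ι hs))
  (cong₂ _+_ (wedge-vanish (act raising (δ (ι a))) G (All.map shifted (Above-All ab))) (moved hs ab))
  where
  G = slater (ι (2 ℕ.+ a)) n
  shifted : ∀ {h} → a ≤ h → act raising (δ (ι a)) (ι h) ≡ 0ℤ
  shifted {h} a≤h = trans (act-raising (δ (ι a)) (ι h))
    (trans (δ-ι a (2 ℕ.+ h)) (kr-< (ℕP.≤-trans (s≤s a≤h) (ℕP.n≤1+n _))))
  moved : ∀ hs → Above a hs → wedge (δ (ι a)) (oneBody raising G) (map ι hs) ≡ 0ℤ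
  moved []       _          = refl
  moved (b ∷ hs) (a≤b ∷ ab) = trans (wedge-δ (oneBody raising G) a≤b ab) rest
    where
    rest : kr b a * oneBody raising G (map ι hs) ≡ 0ℤ
    rest with a ℕ.≟ b
    ... | yes refl = trans (cong (kr a a *_) (raising-slater (2 ℕ.+ a) n hs ab)) (ℤP.*-zeroʳ (kr a a))
    ... | no a≢b  = cong (_* oneBody raising G (map ι hs)) (kr-< (ℕP.≤∧≢⇒< a≤b a≢b))

module _ (m : ℕ) where

  private
    n = suc m

  -- The candidate for the total number of contacts. Raising by 2 does not commute with x ↦ -x,
  -- which is what destroys oddness.
  touch : ℕ → Fun
  touch t v = wave n t v + oneBody raising (wave n t) v

  touch-alternating : ∀ t → Alternating (touch t)
  touch-alternating t as x y bs = trans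
    (cong₂ _+_ (wave-alternating n t as x y bs) (oneBody-alternating raising (wave-alternating n t) as x y bs))
    (sym (ℤP.neg-distrib-+ (wave n t (as ++ y ∷ x ∷ bs)) _))

  touch-suc : ∀ t v → touch (suc t) v ≡ hop (touch t) v
  touch-suc t v = trans (cong (λ a → wave n (suc t) v + a) (oneBody-hop raising-intertwines (wave n t) v))
    (sym (hop-+ (wave n t) (oneBody raising (wave n t)) v))

  -- Every term that keeps the lowest coordinate at 0 vanishes, since the wave is odd; only raising
  -- that very coordinate survives.
  touch-zero : ∀ t v → touch t (0ℤ ∷ v) ≡ wave n t (ι 1 ∷ v)
  touch-zero t v = begin
    wave n t (0ℤ ∷ v) + (act raising (λ z → wave n t (z ∷ v)) 0ℤ + oneBody raising (λ w → wave n t (0ℤ ∷ w)) v)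
      ≡⟨ cong₂ _+_ (zero-head v) (cong₂ _+_ (act-raising (λ z → wave n t (z ∷ v)) 0ℤ)
           (trans (oneBody-cong raising zero-head v) (oneBody-zero raising v))) ⟩
    0ℤ + (wave n t (ι 1 ∷ v) + 0ℤ)
      ≡⟨ ring (wave n t (ι 1 ∷ v)) ⟩
    wave n t (ι 1 ∷ v) ∎
    where
    zero-head : ∀ v → wave n t (0ℤ ∷ v) ≡ 0ℤ
    zero-head = odd-zero {wave n t} (wave-odd n t) []
    ring : ∀ a → 0ℤ + (a + 0ℤ) ≡ a
    ring = solve-∀

  touch₀ : ∀ h → Chamber h → touch 0 (map ι h) ≡ marked 0 (ρ n) h
  touch₀ h c = begin
    touch 0 (map ι h)         ≡⟨ cong₂ _+_ (wave₀ n h c) (raising-slater 0 n h (chamber-Above h c)) ⟩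
    count 0 (ρ n) h + 0ℤ      ≡⟨ ℤP.+-identityʳ (count 0 (ρ n) h) ⟩
    count 0 (ρ n) h
      -- The starting configuration has exactly one contact, that of its lowest walker; this is
      -- where n ≥ 1 enters.
      ≡⟨ sym (trans (cong (_* count 0 (ρ n) h) (κ-bottom (gaps-above z≤n (gaps-flat 0 m)))) (ℤP.*-identityˡ (count 0 (ρ n) h))) ⟩
    κ (ρ n) * count 0 (ρ n) h ∎

  touch-marked : ∀ t h → Chamber h → touch t (map ι h) ≡ marked t (ρ n) h
  touch-marked zero    h c = touch₀ h c
  touch-marked (suc t) h c = trans (touch-suc t (map ι h)) (trans (step h c) (sym (marked-chamber t (ρ n) h c)))
    where
    hopℕ-touch : ∀ h → Chamber h → hopℕ (λ v → touch t (map ι v)) h ≡ hopℕ (marked t (ρ n)) h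
    hopℕ-touch = hopℕ-chamber (touch t) (marked t (ρ n)) (touch-alternating t) (touch-marked t) (λ v → marked-repeat t (ρ n) v)
    positive : ∀ h → All (0 <_) h → Chamber h →
      hop (touch t) (map ι h) ≡ κ h * count (suc t) (ρ n) h + hopℕ (marked t (ρ n)) h
    positive h ps c = trans (hop-ι-positive (touch t) ps) (trans (hopℕ-touch h c)
      (sym (trans (cong (λ a → a * count (suc t) (ρ n) h + k) (κ-positive ps))
        (trans (cong (_+ k) (ℤP.*-zeroˡ (count (suc t) (ρ n) h))) (ℤP.+-identityˡ k)))))
      where k = hopℕ (marked t (ρ n)) h
    step : ∀ h → Chamber h →
      hop (touch t) (map ι h) ≡ κ h * count (suc t) (ρ n) h + hopℕ (marked t (ρ n)) h
    step []           c = positive [] [] c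
    step (suc a ∷ hs) c = positive (suc a ∷ hs) (s≤s z≤n ∷ gaps-above z≤n c) c
    -- With the lowest walker on the floor, the free hop has an additional branch through coordinate
    -- 0. Its value is the count at the present end point, which is the new contact with `κ` equal
    -- to 1.
    step (zero ∷ hs)  c = begin
      hop (λ v → touch t (ι 1 ∷ v)) (map ι hs) + hop (λ v → touch t (0ℤ ∷ v)) (map ι hs)
        ≡⟨ cong₂ _+_ (hop-ι-positive (λ v → touch t (ι 1 ∷ v)) pos) returns ⟩
      hopℕ (λ v → touch t (ι 1 ∷ map ι v)) hs + k
        ≡⟨ ring (hopℕ (λ v → touch t (ι 1 ∷ map ι v)) hs) k ⟩
      1ℤ * k + (hopℕ (λ v → touch t (ι 1 ∷ map ι v)) hs + 0ℤ)
        ≡⟨ cong₂ (λ a b → a * k + b) (sym (κ-bottom pos)) (hopℕ-touch (0 ∷ hs) c) ⟩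
      κ (0 ∷ hs) * k + hopℕ (marked t (ρ n)) (0 ∷ hs) ∎
      where
      k = count (suc t) (ρ n) (0 ∷ hs)
      pos : All (0 <_) hs
      pos = gaps-above z≤n c
      returns : hop (λ v → touch t (0ℤ ∷ v)) (map ι hs) ≡ k
      returns = begin
        hop (λ v → touch t (0ℤ ∷ v)) (map ι hs)
          ≡⟨ hop-cong (touch-zero t) (map ι hs) ⟩
        hop (λ v → wave n t (ι 1 ∷ v)) (map ι hs)
          ≡⟨ sym (ℤP.+-identityʳ (hop (λ v → wave n t (ι 1 ∷ v)) (map ι hs))) ⟩
        hop (λ v → wave n t (ι 1 ∷ v)) (map ι hs) + 0ℤ
          -- The zero is replaced by the branch of the odd wave through 0, which completes a full
          -- hop of the wave.
          ≡⟨ cong (λ a → hop (λ v → wave n t (ι 1 ∷ v)) (map ι hs) + a) (sym (hop-vanish (odd-zero {wave n t} (wave-odd n t) []) (map ι hs))) ⟩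
        wave n (suc t) (map ι (0 ∷ hs))
          ≡⟨ wave-count n (suc t) (0 ∷ hs) c ⟩
        k ∎
      ring : ∀ a k → a + k ≡ 1ℤ * k + (a + 0ℤ)
      ring = solve-∀

-- The flat end point

progression raisedTop : ℤ → ℕ → List ℤ
progression k zero    = []
progression k (suc n) = k ∷ progression (suc² k) n
raisedTop k zero    = suc² k ∷ []
raisedTop k (suc n) = k ∷ raisedTop (suc² k) n

map-ι-flat : ∀ a n → map ι (flat a n) ≡ progression (ι a) n
map-ι-flat a zero    = refl
map-ι-flat a (suc n) = cong (ι a ∷_) (map-ι-flat (2 ℕ.+ a) n)

-- Moving one point of a gapless progression makes two points collide, unless the top moves up or the bottom moves down.
oneBody-progression : ∀ H F → Alternating F → ∀ k m → oneBody H F (progression k (suc m)) ≡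
  (up H (raise m k) * F (raisedTop k m) + staySum H k (suc m) * F (progression k (suc m)))
    + down H k * F (pred² k ∷ progression (suc² k) m)
oneBody-progression H F alt k zero =
  ring (up H k) (F (suc² k ∷ [])) (stay H k) (F (k ∷ [])) (down H k) (F (pred² k ∷ []))
  where
  ring : ∀ u a s b d c → (u * a + d * c + s * b) + 0ℤ ≡ (u * a + (s + 0ℤ) * b) + d * c
  ring = solve-∀
oneBody-progression H F alt k (suc m) = begin
  (up H k * F (suc² k ∷ suc² k ∷ rest) + d * e + s * b) + oneBody H (λ v → F (k ∷ v)) (progression (suc² k) (suc m))
    ≡⟨ cong₂ (λ x y → (up H k * x + d * e + s * b) + y)
         (alternating-repeat {F} alt [] (suc² k) rest)
         (trans (oneBody-progression H (λ v → F (k ∷ v)) (λ as → alt (k ∷ as)) (suc² k) m)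
           (cong (λ x → (u * a + S * b) + down H (suc² k) * x)
             (trans (cong (λ j → F (k ∷ j ∷ rest)) (pred²-suc² k)) (alternating-repeat {F} alt [] k rest)))) ⟩
  (up H k * 0ℤ + d * e + s * b) + ((u * a + S * b) + down H (suc² k) * 0ℤ)
    ≡⟨ ring (up H k) d e s b u a S (down H (suc² k)) ⟩
  (u * a + (s + S) * b) + d * e ∎
  where
  rest = progression (suc² (suc² k)) m
  d = down H k
  s = stay H k
  u = up H (raise m (suc² k))
  S = staySum H (suc² k) (suc m)
  a = F (k ∷ raisedTop (suc² k) m)
  b = F (progression k (suc (suc m)))
  e = F (pred² k ∷ progression (suc² k) (suc m))
  ring : ∀ w d e s b u a S z →
    (w * 0ℤ + d * e + s * b) + ((u * a + S * b) + z * 0ℤ) ≡ (u * a + (s + S) * b) + d * e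
  ring = solve-∀

-- Ladder operators and the eigenvalue equation at the flat end point

raise-closed : ∀ n k → raise n k ≡ k + (+ 2) * + n
raise-closed zero    k = ring k
  where
  ring : ∀ k → k ≡ k + (+ 2) * 0ℤ
  ring = solve-∀
raise-closed (suc n) k = trans (raise-closed n (suc² k)) (ring k (+ n))
  where
  ring : ∀ k n → (1ℤ + (1ℤ + k)) + (+ 2) * n ≡ k + (+ 2) * (1ℤ + n)
  ring = solve-∀

-- With f ↦ (x+s) f(x+1) + (x−s) f(x−1) for s = p and s = q − 1 this is the product of two operators;
-- each of them satisfies J_{s+1} L = L J_s for the one-particle step L f x = f(x+1) + f(x−1).
ladder : ℤ → ℤ → Shift
ladder p q = record
  { up   = λ x → (x + p) * (x + q)
  ; down = λ x → (p - x) * (q - x)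
  ; stay = λ x → (+ 2) * (x * x) + (+ 2) * (p * ((+ 2) - q)) }

ladder-reflecting : ∀ p q → Reflecting (ladder p q)
ladder-reflecting p q = record { up-neg = λ x → ring₁ p q x; stay-neg = λ x → ring₂ p q x }
  where
  ring₁ : ∀ p q x → (- x + p) * (- x + q) ≡ (p - x) * (q - x)
  ring₁ = solve-∀
  ring₂ : ∀ p q x → (+ 2) * (- x * - x) + (+ 2) * (p * ((+ 2) - q)) ≡ (+ 2) * (x * x) + (+ 2) * (p * ((+ 2) - q))
  ring₂ = solve-∀

ladder-intertwines : ∀ a b τ → Intertwines (ladder (τ + a) (τ + b)) (ladder (sucℤ τ + a) (sucℤ τ + b))
ladder-intertwines a b τ = record
  { up-suc = ring₁ a b τ; down-pred = ring₂ a b τ; right = ring₃ a b τ; left = ring₄ a b τ }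
  where
  ring₁ : ∀ a b τ x → (x + ((1ℤ + τ) + a)) * (x + ((1ℤ + τ) + b)) ≡ ((1ℤ + x) + (τ + a)) * ((1ℤ + x) + (τ + b))
  ring₁ = solve-∀
  ring₂ : ∀ a b τ x → (((1ℤ + τ) + a) - x) * (((1ℤ + τ) + b) - x) ≡ ((τ + a) - (- 1ℤ + x)) * ((τ + b) - (- 1ℤ + x))
  ring₂ = solve-∀
  ring₃ : ∀ a b τ x →
    (x + ((1ℤ + τ) + a)) * (x + ((1ℤ + τ) + b))
      + ((+ 2) * (x * x) + (+ 2) * (((1ℤ + τ) + a) * ((+ 2) - ((1ℤ + τ) + b))))
    ≡ ((- 1ℤ + x) + (τ + a)) * ((- 1ℤ + x) + (τ + b))
      + ((+ 2) * ((1ℤ + x) * (1ℤ + x)) + (+ 2) * ((τ + a) * ((+ 2) - (τ + b))))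
  ring₃ = solve-∀
  ring₄ : ∀ a b τ x →
    (((1ℤ + τ) + a) - x) * (((1ℤ + τ) + b) - x)
      + ((+ 2) * (x * x) + (+ 2) * (((1ℤ + τ) + a) * ((+ 2) - ((1ℤ + τ) + b))))
    ≡ ((τ + a) - (1ℤ + x)) * ((τ + b) - (1ℤ + x))
      + ((+ 2) * ((- 1ℤ + x) * (- 1ℤ + x)) + (+ 2) * ((τ + a) * ((+ 2) - (τ + b))))
  ring₄ = solve-∀

-- Only a difference of two diagonal sums enters the final relation. Term by term the squares of k +
-- 2i cancel, so no sum of squares has to be evaluated and what is left sums to a multiple of n.
staySum-ladder : ∀ p q p′ q′ y k n →
  staySum (ladder p q) k n ≡ staySum (ladder p′ q′) (k + y) n
    + (+ 2) * (+ n * ((p * ((+ 2) - q) - p′ * ((+ 2) - q′)) - y * y - (+ 2) * (y * (k + + n - 1ℤ))))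
staySum-ladder p q p′ q′ y k zero    = sym (ring ((p * ((+ 2) - q) - p′ * ((+ 2) - q′)) - y * y - (+ 2) * (y * (k + + 0 - 1ℤ))))
  where
  ring : ∀ a → 0ℤ + (+ 2) * (0ℤ * a) ≡ 0ℤ
  ring = solve-∀
staySum-ladder p q p′ q′ y k (suc n) = begin
  stay (ladder p q) k + staySum (ladder p q) (suc² k) n
    ≡⟨ cong (λ s → stay (ladder p q) k + s) (staySum-ladder p q p′ q′ y (suc² k) n) ⟩
  stay (ladder p q) k + (staySum (ladder p′ q′) (suc² k + y) n + c (suc² k))
    ≡⟨ cong (λ j → stay (ladder p q) k + (staySum (ladder p′ q′) j n + c (suc² k))) (shift k y) ⟩
  stay (ladder p q) k + (s + c (suc² k))
    ≡⟨ ring p q p′ q′ y k (+ n) s ⟩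
  _ ∎
  where
  s = staySum (ladder p′ q′) (suc² (k + y)) n
  c = λ k → (+ 2) * (+ n * ((p * ((+ 2) - q) - p′ * ((+ 2) - q′)) - y * y - (+ 2) * (y * (k + + n - 1ℤ))))
  shift : ∀ k y → suc² k + y ≡ suc² (k + y)
  shift k y = r k y
    where
    r : ∀ k y → (1ℤ + (1ℤ + k)) + y ≡ 1ℤ + (1ℤ + (k + y))
    r = solve-∀
  ring : ∀ p q p′ q′ y k n s →
    ((+ 2) * (k * k) + (+ 2) * (p * ((+ 2) - q)))
      + (s + (+ 2) * (n * ((p * ((+ 2) - q) - p′ * ((+ 2) - q′)) - y * y - (+ 2) * (y * ((1ℤ + (1ℤ + k)) + n - 1ℤ)))))
    ≡ (((+ 2) * ((k + y) * (k + y)) + (+ 2) * (p′ * ((+ 2) - q′))) + s)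
      + (+ 2) * ((1ℤ + n) * ((p * ((+ 2) - q) - p′ * ((+ 2) - q′)) - y * y - (+ 2) * (y * (k + (1ℤ + n) - 1ℤ))))
  ring = solve-∀

module _ (m t y : ℕ) where

  private
    n = suc m
    N = + n
    T = + t
    Y = + y
    a = ι y - T
    b = 1ℤ + (+ 2) * N
    H : ℕ → Shift
    H τ = ladder (+ τ + a) (+ τ + b)
    S₀ = staySum (H 0) 1ℤ n
    Sₜ = staySum (H t) (ι y) n
    E = progression (ι y) n
    F = wave n t

    top : down (H 0) (raise n 1ℤ) ≡ 0ℤ
    top = trans (cong (down (H 0)) (raise-closed n 1ℤ)) (ring a N)
      where
      ring : ∀ a N → ((0ℤ + a) - (1ℤ + (+ 2) * N)) * ((0ℤ + (1ℤ + (+ 2) * N)) - (1ℤ + (+ 2) * N)) ≡ 0ℤ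
      ring = solve-∀

    eigen : oneBody (H t) F E ≡ (S₀ - up (H 0) (- 1ℤ)) * F E
    eigen = evolve-eigen H (λ τ → ladder-intertwines a b (+ τ)) (S₀ - up (H 0) (- 1ℤ))
      (oneBody-slater₁ (ladder-reflecting (0ℤ + a) (0ℤ + b)) m top) t E

    bottom : down (H t) (ι y) ≡ 0ℤ
    bottom = ring Y T b
      where
      ring : ∀ Y T b → ((T + ((1ℤ + Y) - T)) - (1ℤ + Y)) * ((T + b) - (1ℤ + Y)) ≡ 0ℤ
      ring = solve-∀

    expand : oneBody (H t) F E ≡
      up (H t) (ι y + (+ 2) * + m) * F (raisedTop (ι y) m) + Sₜ * F E
    expand = trans (oneBody-progression (H t) F (wave-alternating n t) (ι y) m)
      (trans (cong₂ (λ r d → (up (H t) r * F (raisedTop (ι y) m) + Sₜ * F E) + d * F (pred² (ι y) ∷ progression (suc² (ι y)) m))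
        (raise-closed m (ι y)) bottom) (ring (up (H t) (ι y + (+ 2) * + m) * F (raisedTop (ι y) m) + Sₜ * F E)
          (F (pred² (ι y) ∷ progression (suc² (ι y)) m))))
      where
      ring : ∀ a b → a + 0ℤ * b ≡ a
      ring = solve-∀

    -- At the top coordinate x = y + 2n - 1 the constants p = y + 1 and q = t + 2n + 1 give x + p =
    -- 2(y + n) and x + q = t + y + 4n: twice the denominator of the theorem. The sums stay
    -- unreduced to match the unfolded `ladder`.
    core : ∀ M T Y r s S W →
      ((1ℤ + Y + (+ 2) * M) + (T + (1ℤ + Y - T))) * ((1ℤ + Y + (+ 2) * M) + (T + (1ℤ + (+ 2) * (1ℤ + M)))) * r + S * s ≡ W →
      ((+ 2) * (Y + (1ℤ + M))) * (T + Y + (+ 4) * (1ℤ + M)) * r ≡ W - S * s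
    core M T Y r s S W eq = trans (ring M T Y r s S) (cong (λ w → w - S * s) eq)
      where
      ring : ∀ M T Y r s S →
        ((+ 2) * (Y + (1ℤ + M))) * (T + Y + (+ 4) * (1ℤ + M)) * r ≡
        ((1ℤ + Y + (+ 2) * M) + (T + (1ℤ + Y - T))) * ((1ℤ + Y + (+ 2) * M) + (T + (1ℤ + (+ 2) * (1ℤ + M)))) * r + S * s - S * s
      ring = solve-∀

    -- Eigenvalue minus the diagonal sum `S` at the end point: `S` cancels, and the rest factors
    -- into twice the numerator of the theorem.
    gap : ∀ M T Y s S →
      ((S + (+ 2) * ((1ℤ + M) * (((0ℤ + (1ℤ + Y - T)) * ((+ 2) - (0ℤ + (1ℤ + (+ 2) * (1ℤ + M))))
          - (T + (1ℤ + Y - T)) * ((+ 2) - (T + (1ℤ + (+ 2) * (1ℤ + M))))) - Y * Y - (+ 2) * (Y * (1ℤ + (1ℤ + M) - 1ℤ)))))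
        - (- 1ℤ + (0ℤ + (1ℤ + Y - T))) * (- 1ℤ + (0ℤ + (1ℤ + (+ 2) * (1ℤ + M))))) * s - S * s
      ≡ ((+ 2) * (1ℤ + M)) * (T - Y) * (Y + (+ 2) * (1ℤ + M) + 1ℤ) * s
    gap = solve-∀

  raised-ratio : (+ 2 * (Y + N)) * (T + Y + + 4 * N) * F (raisedTop (ι y) m)
               ≡ (+ 2 * N) * (T - Y) * (Y + + 2 * N + 1ℤ) * F E
  raised-ratio = trans
    (core (+ m) T Y (F (raisedTop (ι y) m)) (F E) Sₜ ((S₀ - up (H 0) (- 1ℤ)) * F E) (trans (sym expand) eigen))
    (trans (cong (λ S → (S - up (H 0) (- 1ℤ)) * F E - Sₜ * F E)
        (staySum-ladder (0ℤ + a) (0ℤ + b) (T + a) (T + b) Y 1ℤ n))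
      (gap (+ m) T Y (F E) Sₜ))

  marked-flat : marked t (ρ n) (flat y n) ≡ count t (ρ n) (flat y n) + F (raisedTop (ι y) m)
  marked-flat = begin
    marked t (ρ n) (flat y n)
      ≡⟨ sym (touch-marked m t (flat y n) (chamber-flat y n)) ⟩
    F (map ι (flat y n)) + oneBody raising F (map ι (flat y n))
      ≡⟨ cong₂ _+_ (wave-count n t (flat y n) (chamber-flat y n))
           (trans (cong (oneBody raising F) (map-ι-flat y n)) (trans (oneBody-progression raising F (wave-alternating n t) (ι y) m)
             (trans (cong (λ s → (1ℤ * F (raisedTop (ι y) m) + s * F E) + 0ℤ * F (pred² (ι y) ∷ progression (suc² (ι y)) m))
               (no-stay (ι y) n)) (ring (F (raisedTop (ι y) m)) (F E)
               (F (pred² (ι y) ∷ progression (suc² (ι y)) m)))))) ⟩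
    count t (ρ n) (flat y n) + F (raisedTop (ι y) m) ∎
    where
    no-stay : ∀ k n → staySum raising k n ≡ 0ℤ
    no-stay k zero    = refl
    no-stay k (suc n) = trans (ℤP.+-identityˡ (staySum raising (suc² k) n)) (no-stay (suc² k) n)
    ring : ∀ a b c → (1ℤ * a + 0ℤ * b) + 0ℤ * c ≡ a
    ring = solve-∀

  count-flat : F E ≡ count t (ρ n) (flat y n)
  count-flat = trans (cong F (sym (map-ι-flat y n))) (wave-count n t (flat y n) (chamber-flat y n))

  marked-ratio : (+ 2 * (Y + N)) * (T + Y + + 4 * N) * (marked t (ρ n) (flat y n) - count t (ρ n) (flat y n))
               ≡ (+ 2 * N) * (T - Y) * (Y + + 2 * N + 1ℤ) * count t (ρ n) (flat y n)
  marked-ratio = begin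
    D * (marked t (ρ n) (flat y n) - c) ≡⟨ cong (λ x → D * (x - c)) marked-flat ⟩
    D * (c + F (raisedTop (ι y) m) - c) ≡⟨ cong (D *_) (ring c (F (raisedTop (ι y) m))) ⟩
    D * F (raisedTop (ι y) m)           ≡⟨ raised-ratio ⟩
    (+ 2 * N) * (T - Y) * (Y + + 2 * N + 1ℤ) * F E ≡⟨ cong ((+ 2 * N) * (T - Y) * (Y + + 2 * N + 1ℤ) *_) count-flat ⟩
    _ ∎
    where
    D = (+ 2 * (Y + N)) * (T + Y + + 4 * N)
    c = count t (ρ n) (flat y n)
    ring : ∀ c x → c + x - c ≡ x
    ring = solve-∀

-- Families of walks

variable
  A B : Set

total : List A → (A → ℤ) → ℤ
total []       φ = 0ℤ
total (x ∷ xs) φ = φ x + total xs φ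

total-cong : ∀ (xs : List A) {φ ψ} → (∀ x → φ x ≡ ψ x) → total xs φ ≡ total xs ψ
total-cong []       e = refl
total-cong (x ∷ xs) e = cong₂ _+_ (e x) (total-cong xs e)

total-linear : ∀ (xs : List A) → Linear (total xs)
total-linear []       = record
  { cong-L = λ _ → refl; zero-L = refl; plus-L = λ _ _ → refl; scale-L = λ c _ → sym (ℤP.*-zeroʳ c) }
total-linear (x ∷ xs) = record
  { cong-L  = total-cong (x ∷ xs)
  ; zero-L  = cong (λ s → 0ℤ + s) zero-L
  ; plus-L  = λ f g → trans (cong (λ s → f x + g x + s) (plus-L f g)) (interchange (f x) (g x) (total xs f) (total xs g))
  ; scale-L = λ c f → trans (cong (λ s → c * f x + s) (scale-L c f)) (sym (ℤP.*-distribˡ-+ c (f x) (total xs f))) }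
  where open Linear (total-linear xs)

total-++ : ∀ (xs ys : List A) φ → total (xs ++ ys) φ ≡ total xs φ + total ys φ
total-++ []       ys φ = sym (ℤP.+-identityˡ (total ys φ))
total-++ (x ∷ xs) ys φ = trans (cong (λ s → φ x + s) (total-++ xs ys φ)) (sym (ℤP.+-assoc (φ x) (total xs φ) (total ys φ)))

total-map : ∀ (g : A → B) xs φ → total (map g xs) φ ≡ total xs (λ x → φ (g x))
total-map g []       φ = refl
total-map g (x ∷ xs) φ = cong (λ s → φ (g x) + s) (total-map g xs φ)

total-concatMap : ∀ (f : A → List B) xs φ → total (concatMap f xs) φ ≡ total xs (λ x → total (f x) φ)
total-concatMap f []       φ = refl
total-concatMap f (x ∷ xs) φ = trans (total-++ (f x) (concatMap f xs) φ) (cong (λ s → total (f x) φ + s) (total-concatMap f xs φ))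

-- The local function of `walks` is recovered by unification: the witness is solved from the
-- unfolded definition.
pick-exists : ∀ t a b → ∃ λ (f : List Bool → List (List ℕ)) → walks t a b ≡ concatMap f (stepSeqs t)
pick-exists t a b = _ , refl

pick : ℕ → ℕ → ℕ → List Bool → List (List ℕ)
pick t a b = proj₁ (pick-exists t a b)

ending : ℕ → ℕ → Maybe (List ℕ) → (List ℕ → ℤ) → ℤ
ending d b nothing   φ = 0ℤ
ending d b (just hs) φ = total (if last d hs ≡ᵇ b then hs ∷ [] else []) φ

total-pick : ∀ t a b s φ → total (pick t a b s) φ ≡ ending a b (heights a s) φ
total-pick t a b s φ with heights a s
... | nothing = refl
... | just hs = refl

follow : ℕ → ℕ → List Bool → (List ℕ → ℤ) → ℤ
follow a       b []          φ = kr a b * φ (a ∷ [])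
follow a       b (true ∷ s)  φ = follow (suc a) b s (λ p → φ (a ∷ p))
follow a       b (false ∷ s) φ = below (λ k → follow k b s (λ p → φ (a ∷ p))) a

prepended : ∀ c a hs (φ : List ℕ → ℤ) →
  total (if c then (a ∷ hs) ∷ [] else []) φ ≡ total (if c then hs ∷ [] else []) (λ p → φ (a ∷ p))
prepended true  a hs φ = refl
prepended false a hs φ = refl

-- The default `d` has to vary in the induction, because `last d (a ∷ hs)` is `last a hs`.
ending-follow : ∀ d a b s φ → ending d b (heights a s) φ ≡ follow a b s φ
ending-follow d a b [] φ with a ≡ᵇ b
... | true  = ring (φ (a ∷ []))
  where
  ring : ∀ x → x + 0ℤ ≡ 1ℤ * x
  ring = solve-∀
... | false = refl
ending-follow d a b (true ∷ s) φ with heights (suc a) s | ending-follow a (suc a) b s (λ p → φ (a ∷ p))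
... | nothing | e = e
... | just hs | e = trans (prepended (last a hs ≡ᵇ b) a hs φ) e
ending-follow d zero    b (false ∷ s) φ = refl
ending-follow d (suc a) b (false ∷ s) φ with heights a s | ending-follow (suc a) a b s (λ p → φ (suc a ∷ p))
... | nothing | e = e
... | just hs | e = trans (prepended (last (suc a) hs ≡ᵇ b) (suc a) hs φ) e

total-walks : ∀ t a b φ → total (walks t a b) φ ≡ total (stepSeqs t) (λ s → follow a b s φ)
total-walks t a b φ = trans (total-concatMap (pick t a b) (stepSeqs t) φ)
  (total-cong (stepSeqs t) (λ s → trans (total-pick t a b s φ) (ending-follow a a b s φ)))

total-walks-zero : ∀ a b φ → total (walks 0 a b) φ ≡ kr a b * φ (a ∷ [])
total-walks-zero a b φ = trans (total-walks 0 a b φ) (ℤP.+-identityʳ (kr a b * φ (a ∷ [])))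

total-walks-suc : ∀ t a b φ → total (walks (suc t) a b) φ ≡
  total (walks t (suc a) b) (λ p → φ (a ∷ p)) + below (λ k → total (walks t k b) (λ p → φ (a ∷ p))) a
total-walks-suc t a b φ = begin
  total (walks (suc t) a b) φ
    ≡⟨ total-walks (suc t) a b φ ⟩
  total (stepSeqs (suc t)) (λ s → follow a b s φ)
    ≡⟨ total-concatMap (λ s → (true ∷ s) ∷ (false ∷ s) ∷ []) (stepSeqs t) (λ s → follow a b s φ) ⟩
  total (stepSeqs t) (λ s → follow (suc a) b s φ′ + (below (λ k → follow k b s φ′) a + 0ℤ))
    ≡⟨ plus-L (λ s → follow (suc a) b s φ′) (λ s → below (λ k → follow k b s φ′) a + 0ℤ) ⟩
  total (stepSeqs t) (λ s → follow (suc a) b s φ′) + total (stepSeqs t) (λ s → below (λ k → follow k b s φ′) a + 0ℤ)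
    ≡⟨ cong₂ _+_ (sym (total-walks t (suc a) b φ′)) (descend a) ⟩
  _ ∎
  where
  open Linear (total-linear (stepSeqs t))
  φ′ = λ p → φ (a ∷ p)
  descend : ∀ c → total (stepSeqs t) (λ s → below (λ k → follow k b s φ′) c + 0ℤ) ≡ below (λ k → total (walks t k b) φ′) c
  descend zero    = zero-L
  descend (suc c) = trans (total-cong (stepSeqs t) (λ s → ℤP.+-identityʳ (follow c b s φ′))) (sym (total-walks t c b φ′))

-- Starts are arbitrary, because after one step the walkers need not be equally spaced.
joint : ℕ → List ℕ → List ℕ → List (List (List ℕ))
joint t []       []       = [] ∷ []
joint t (x ∷ xs) (e ∷ es) = concatMap (λ p → map (p ∷_) (joint t xs es)) (walks t x e)
joint t _        _        = []

tuples-joint : ∀ n t y off → tuples n t y off ≡ joint t (flat off n) (flat (y ℕ.+ off) n)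
tuples-joint zero    t y off = refl
tuples-joint (suc n) t y off = cong (λ J → concatMap (λ p → map (p ∷_) J) (walks t off (y ℕ.+ off)))
  (trans (tuples-joint n t y (2 ℕ.+ off))
    (cong (λ e → joint t (flat (2 ℕ.+ off) n) (flat e n)) (trans (ℕP.+-suc y (suc off)) (cong suc (ℕP.+-suc y off)))))

total-joint : ∀ t x xs e es Φ → total (joint t (x ∷ xs) (e ∷ es)) Φ ≡
  total (walks t x e) (λ p → total (joint t xs es) (λ Q → Φ (p ∷ Q)))
total-joint t x xs e es Φ = trans (total-concatMap (λ p → map (p ∷_) (joint t xs es)) (walks t x e) Φ)
  (total-cong (walks t x e) (λ p → total-map (p ∷_) (joint t xs es) Φ))

-- The length is recorded because `zipWith` truncates: prepending a column is faithful only when the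
-- lengths agree.
total-joint-cong : ∀ t xs es {Φ Ψ} → (∀ Q → length Q ≡ length xs → Φ Q ≡ Ψ Q) → total (joint t xs es) Φ ≡ total (joint t xs es) Ψ
total-joint-cong t []       []       e = cong (λ a → a + 0ℤ) (e [] refl)
total-joint-cong t []       (_ ∷ _)  e = refl
total-joint-cong t (_ ∷ _)  []       e = refl
total-joint-cong t (x ∷ xs) (z ∷ es) {Φ} {Ψ} e = trans (total-joint t x xs z es Φ)
  (trans (total-cong (walks t x z) (λ p → total-joint-cong t xs es (λ Q l → e (p ∷ Q) (cong suc l))))
    (sym (total-joint t x xs z es Ψ)))

total-joint-zero : ∀ xs es Φ → total (joint 0 xs es) Φ ≡ same xs es * Φ (map (_∷ []) xs)
total-joint-zero []       []       Φ = ring (Φ [])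
  where
  ring : ∀ x → x + 0ℤ ≡ 1ℤ * x
  ring = solve-∀
total-joint-zero []       (_ ∷ _)  Φ = refl
total-joint-zero (_ ∷ _)  []       Φ = refl
total-joint-zero (x ∷ xs) (e ∷ es) Φ = begin
  total (joint 0 (x ∷ xs) (e ∷ es)) Φ
    ≡⟨ total-joint 0 x xs e es Φ ⟩
  total (walks 0 x e) (λ p → total (joint 0 xs es) (λ Q → Φ (p ∷ Q)))
    ≡⟨ total-walks-zero x e (λ p → total (joint 0 xs es) (λ Q → Φ (p ∷ Q))) ⟩
  kr x e * total (joint 0 xs es) (λ Q → Φ ((x ∷ []) ∷ Q))
    ≡⟨ cong (kr x e *_) (total-joint-zero xs es (λ Q → Φ ((x ∷ []) ∷ Q))) ⟩
  kr x e * (same xs es * Φ (map (_∷ []) (x ∷ xs)))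
    ≡⟨ sym (ℤP.*-assoc (kr x e) (same xs es) _) ⟩
  _ ∎

-- The transposition from a tuple of walks to a walk of tuples: the common first column `xs` is
-- split off, and a family from a neighbouring configuration remains.
total-joint-suc : ∀ t xs es Φ → total (joint (suc t) xs es) Φ ≡
  hopℕ (λ v → total (joint t v es) (λ Q → Φ (zipWith _∷_ xs Q))) xs
total-joint-suc t []       []       Φ = refl
total-joint-suc t []       (_ ∷ _)  Φ = refl
total-joint-suc t (x ∷ xs) []       Φ = sym (Linear.zero-L (hopℕ-linear (x ∷ xs)))
total-joint-suc t (x ∷ xs) (e ∷ es) Φ = begin
  total (joint (suc t) (x ∷ xs) (e ∷ es)) Φ
    ≡⟨ total-joint (suc t) x xs e es Φ ⟩
  total (walks (suc t) x e) (λ p → total (joint (suc t) xs es) (λ Q → Φ (p ∷ Q)))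
    ≡⟨ total-cong (walks (suc t) x e) (λ p → total-joint-suc t xs es (λ Q → Φ (p ∷ Q))) ⟩
  total (walks (suc t) x e) (λ p → hopℕ (λ v → total (joint t v es) (λ Q → Φ (p ∷ zipWith _∷_ xs Q))) xs)
    ≡⟨ total-walks-suc t x e (λ p → hopℕ (λ v → total (joint t v es) (λ Q → Φ (p ∷ zipWith _∷_ xs Q))) xs) ⟩
  total (walks t (suc x) e) (λ p → hopℕ (λ v → G v p) xs) + below (λ k → total (walks t k e) (λ p → hopℕ (λ v → G v p) xs)) x
    ≡⟨ cong₂ _+_ (regroup (suc x)) (below-cong regroup x) ⟩
  _ ∎
  where
  G : List ℕ → List ℕ → ℤ
  G v p = total (joint t v es) (λ Q → Φ (zipWith _∷_ (x ∷ xs) (p ∷ Q)))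
  regroup : ∀ k → total (walks t k e) (λ p → hopℕ (λ v → G v p) xs) ≡
    hopℕ (λ v → total (joint t (k ∷ v) (e ∷ es)) (λ Q → Φ (zipWith _∷_ (x ∷ xs) Q))) xs
  regroup k = trans (hopℕ-commute (total-linear (walks t k e)) G xs)
    (hopℕ-cong (λ v → sym (total-joint t k v e es (λ Q → Φ (zipWith _∷_ (x ∷ xs) Q)))) xs)

∧-interchange : ∀ a b c d → (a ∧ b) ∧ (c ∧ d) ≡ (a ∧ c) ∧ (b ∧ d)
∧-interchange false _     _     _ = refl
∧-interchange true  true  _     _ = refl
∧-interchange true  false false _ = refl
∧-interchange true  false true  _ = refl

-- `disjoint` compares heights at equal times, so the verdict on the first column separates from the
-- rest.
disjoint-prepend : ∀ x p xs Q → length Q ≡ length xs → and (map (disjoint (x ∷ p)) (zipWith _∷_ xs Q)) ≡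
  and (map (λ b → not (x ≡ᵇ b)) xs) ∧ and (map (disjoint p) Q)
disjoint-prepend x p []       []      _ = refl
disjoint-prepend x p (y ∷ xs) (q ∷ Q) l = trans
  (cong ((not (x ≡ᵇ y) ∧ disjoint p q) ∧_) (disjoint-prepend x p xs Q (ℕP.suc-injective l)))
  (∧-interchange (not (x ≡ᵇ y)) (disjoint p q) _ _)

vicious-prepend : ∀ xs Q → length Q ≡ length xs → vicious (zipWith _∷_ xs Q) ≡ distinct xs ∧ vicious Q
vicious-prepend []       []      _ = refl
vicious-prepend (x ∷ xs) (p ∷ Q) l = trans
  (cong₂ _∧_ (disjoint-prepend x p xs Q (ℕP.suc-injective l)) (vicious-prepend xs Q (ℕP.suc-injective l)))
  (∧-interchange (and (map (λ b → not (x ≡ᵇ b)) xs)) (and (map (disjoint p) Q)) (distinct xs) (vicious Q))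

zeros : List ℕ → ℕ
zeros h = length (filter (ℕ._≟ 0) h)

+-swap : ∀ a b c → a ℕ.+ (b ℕ.+ c) ≡ b ℕ.+ (a ℕ.+ c)
+-swap = ℕSolver.solve-∀

contacts-prepend : ∀ xs Q → length Q ≡ length xs → contacts (zipWith _∷_ xs Q) ≡ zeros xs ℕ.+ contacts Q
contacts-prepend []           []      _ = refl
contacts-prepend (zero ∷ xs)  (p ∷ Q) l = cong suc (trans
  (cong (zeros p ℕ.+_) (contacts-prepend xs Q (ℕP.suc-injective l))) (+-swap (zeros p) (zeros xs) (contacts Q)))
contacts-prepend (suc x ∷ xs) (p ∷ Q) l = trans
  (cong (zeros p ℕ.+_) (contacts-prepend xs Q (ℕP.suc-injective l))) (+-swap (zeros p) (zeros xs) (contacts Q))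

vicious-singletons : ∀ xs → vicious (map (_∷ []) xs) ≡ distinct xs
vicious-singletons []       = refl
vicious-singletons (x ∷ xs) = cong₂ _∧_ (apart xs) (vicious-singletons xs)
  where
  apart : ∀ ys → and (map (disjoint (x ∷ [])) (map (_∷ []) ys)) ≡ and (map (λ b → not (x ≡ᵇ b)) ys)
  apart []       = refl
  apart (y ∷ ys) = cong₂ _∧_ (∧-identityʳ (not (x ≡ᵇ y))) (apart ys)

contacts-singletons : ∀ xs → contacts (map (_∷ []) xs) ≡ zeros xs
contacts-singletons []           = refl
contacts-singletons (zero ∷ xs)  = cong suc (contacts-singletons xs)
contacts-singletons (suc x ∷ xs) = contacts-singletons xs

𝟙-∧ : ∀ a b → 𝟙 (a ∧ b) ≡ 𝟙 a * 𝟙 b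
𝟙-∧ true  b = sym (ℤP.*-identityˡ (𝟙 b))
𝟙-∧ false b = refl

neighbour-length : ∀ {h v} → Neighbour h v → length v ≡ length h
neighbour-length []       = refl
neighbour-length (rise n) = cong suc (neighbour-length n)
neighbour-length (fall n) = cong suc (neighbour-length n)

total-vicious : ∀ t xs es → total (joint t xs es) (λ P → 𝟙 (vicious P)) ≡ count t xs es
total-vicious zero xs es = trans (total-joint-zero xs es (λ P → 𝟙 (vicious P)))
  (trans (cong (λ b → same xs es * 𝟙 b) (vicious-singletons xs)) (ℤP.*-comm (same xs es) (χ xs)))
total-vicious (suc t) xs es = trans (total-joint-suc t xs es (λ P → 𝟙 (vicious P)))
  (trans (hopℕ-cong-neighbour xs step) (hopℕ-* (χ xs) (λ v → count t v es) xs))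
  where
  step : ∀ {v} → Neighbour xs v → total (joint t v es) (λ Q → 𝟙 (vicious (zipWith _∷_ xs Q))) ≡ χ xs * count t v es
  step {v} n = begin
    total (joint t v es) (λ Q → 𝟙 (vicious (zipWith _∷_ xs Q)))
      ≡⟨ total-joint-cong t v es (λ Q l → trans (cong 𝟙 (vicious-prepend xs Q (trans l (neighbour-length n))))
           (𝟙-∧ (distinct xs) (vicious Q))) ⟩
    total (joint t v es) (λ Q → χ xs * 𝟙 (vicious Q))
      ≡⟨ Linear.scale-L (total-linear (joint t v es)) (χ xs) (λ Q → 𝟙 (vicious Q)) ⟩
    χ xs * total (joint t v es) (λ Q → 𝟙 (vicious Q))
      ≡⟨ cong (χ xs *_) (total-vicious t v es) ⟩
    χ xs * count t v es ∎

total-contacts : ∀ t xs es → total (joint t xs es) (λ P → 𝟙 (vicious P) * + contacts P) ≡ marked t xs es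
total-contacts zero xs es = trans (total-joint-zero xs es (λ P → 𝟙 (vicious P) * + contacts P))
  (trans (cong₂ (λ b c → same xs es * (𝟙 b * + c)) (vicious-singletons xs) (contacts-singletons xs))
    (ring (same xs es) (χ xs) (κ xs)))
  where
  ring : ∀ s x k → s * (x * k) ≡ k * (x * s)
  ring = solve-∀
total-contacts (suc t) xs es = begin
  total (joint (suc t) xs es) (λ P → 𝟙 (vicious P) * + contacts P)
    ≡⟨ total-joint-suc t xs es (λ P → 𝟙 (vicious P) * + contacts P) ⟩
  _ ≡⟨ hopℕ-cong-neighbour xs step ⟩
  hopℕ (λ v → χ xs * (κ xs * count t v es + marked t v es)) xs
    ≡⟨ hopℕ-* (χ xs) (λ v → κ xs * count t v es + marked t v es) xs ⟩
  χ xs * hopℕ (λ v → κ xs * count t v es + marked t v es) xs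
    ≡⟨ cong (χ xs *_) (trans (Linear.plus-L (hopℕ-linear xs) (λ v → κ xs * count t v es) (λ v → marked t v es))
         (cong (λ a → a + hopℕ (λ v → marked t v es) xs) (hopℕ-* (κ xs) (λ v → count t v es) xs))) ⟩
  χ xs * (κ xs * hopℕ (λ v → count t v es) xs + hopℕ (λ v → marked t v es) xs)
    ≡⟨ ring (χ xs) (κ xs) _ _ ⟩
  marked (suc t) xs es ∎
  where
  ring : ∀ x k a b → x * (k * a + b) ≡ k * (x * a) + x * b
  ring = solve-∀
  split : ∀ x v k c → (x * v) * (k + c) ≡ x * (k * v + v * c)
  split = solve-∀
  step : ∀ {v} → Neighbour xs v →
    total (joint t v es) (λ Q → 𝟙 (vicious (zipWith _∷_ xs Q)) * + contacts (zipWith _∷_ xs Q)) ≡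
    χ xs * (κ xs * count t v es + marked t v es)
  step {v} n = begin
    _ ≡⟨ total-joint-cong t v es (λ Q l → let l′ = trans l (neighbour-length n) in trans
           (cong₂ (λ b c → 𝟙 b * + c) (vicious-prepend xs Q l′) (contacts-prepend xs Q l′))
           (trans (cong (λ b → b * (κ xs + + contacts Q)) (𝟙-∧ (distinct xs) (vicious Q)))
             (split (χ xs) (𝟙 (vicious Q)) (κ xs) (+ contacts Q)))) ⟩
    total (joint t v es) (λ Q → χ xs * (κ xs * 𝟙 (vicious Q) + 𝟙 (vicious Q) * + contacts Q))
      ≡⟨ scale-L (χ xs) (λ Q → κ xs * 𝟙 (vicious Q) + 𝟙 (vicious Q) * + contacts Q) ⟩
    χ xs * total (joint t v es) (λ Q → κ xs * 𝟙 (vicious Q) + 𝟙 (vicious Q) * + contacts Q)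
      ≡⟨ cong (χ xs *_) (trans (plus-L (λ Q → κ xs * 𝟙 (vicious Q)) (λ Q → 𝟙 (vicious Q) * + contacts Q))
           (cong₂ _+_ (trans (scale-L (κ xs) (λ Q → 𝟙 (vicious Q))) (cong (κ xs *_) (total-vicious t v es)))
             (total-contacts t v es))) ⟩
    χ xs * (κ xs * count t v es + marked t v es) ∎
    where open Linear (total-linear (joint t v es))

total-filter : ∀ (P : A → Bool) xs φ → total (filter (λ x → P x Data.Bool.≟ true) xs) φ ≡ total xs (λ x → 𝟙 (P x) * φ x)
total-filter P []       φ = refl
total-filter P (x ∷ xs) φ with P x
... | true  = cong₂ _+_ (sym (ℤP.*-identityˡ (φ x))) (total-filter P xs φ)
... | false = trans (total-filter P xs φ) (sym (ℤP.+-identityˡ (total xs (λ x → 𝟙 (P x) * φ x))))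

families-total : ∀ n t y φ → total (families n t y) φ ≡ total (joint t (ρ n) (flat y n)) (λ P → 𝟙 (vicious P) * φ P)
families-total n t y φ = trans (total-filter vicious (tuples n t y 0) φ)
  (cong (λ J → total J (λ P → 𝟙 (vicious P) * φ P))
    (trans (tuples-joint n t y 0) (cong (λ e → joint t (ρ n) (flat e n)) (ℕP.+-identityʳ y))))

families-count : ∀ n t y → total (families n t y) (λ _ → 1ℤ) ≡ count t (ρ n) (flat y n)
families-count n t y = trans (families-total n t y (λ _ → 1ℤ))
  (trans (total-cong (joint t (ρ n) (flat y n)) (λ P → ℤP.*-identityʳ (𝟙 (vicious P)))) (total-vicious t (ρ n) (flat y n)))

families-contacts : ∀ n t y → total (families n t y) (λ P → + contacts P) ≡ marked t (ρ n) (flat y n)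
families-contacts n t y = trans (families-total n t y (λ P → + contacts P)) (total-contacts t (ρ n) (flat y n))

-- Generating polynomials

-- For the polynomial p these are the coefficients of κ d/dκ applied to κ^i p, with the factor κ^i
-- removed again.
scaled : ℕ → Poly → Poly
scaled i []       = []
scaled i (a ∷ as) = i ℕ.* a ∷ scaled (suc i) as

mutual
  go : Poly → ℕ → Poly → Poly
  go = _

  -- Both arguments are abstracted so that unification identifies `go` with the local function inside κD.
  κD-go : ∀ a as → κD (a ∷ as) ≡ 0 ∷ go (a ∷ as) 1 as
  κD-go a as with a ∷ as | 1
  ... | p | i = cong (0 ∷_) (refl {x = go p i as})

go-scaled : ∀ p i as → go p i as ≡ scaled i as
go-scaled p i []       = refl
go-scaled p i (a ∷ as) = cong (i ℕ.* a ∷_) (go-scaled p (suc i) as)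

κD-scaled : ∀ p → κD p ≡ scaled 0 p
κD-scaled []       = refl
κD-scaled (a ∷ as) = trans (κD-go a as) (cong (0 ∷_) (go-scaled (a ∷ as) 1 as))

-- The value at κ = 1, kept in the integers so that rationals appear only at the end.
coefficientSum : Poly → ℤ
coefficientSum p = total p (λ a → + a)

coefficientSum-⊕ : ∀ p q → coefficientSum (p ⊕ q) ≡ coefficientSum p + coefficientSum q
coefficientSum-⊕ []      q       = sym (ℤP.+-identityˡ (coefficientSum q))
coefficientSum-⊕ (a ∷ p) []      = sym (ℤP.+-identityʳ (coefficientSum (a ∷ p)))
coefficientSum-⊕ (a ∷ p) (b ∷ q) = trans (cong (λ s → + a + + b + s) (coefficientSum-⊕ p q)) (interchange (+ a) (+ b) (coefficientSum p) (coefficientSum q))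

scaled-⊕ : ∀ i p q → scaled i (p ⊕ q) ≡ scaled i p ⊕ scaled i q
scaled-⊕ i []      q       = refl
scaled-⊕ i (a ∷ p) []      = refl
scaled-⊕ i (a ∷ p) (b ∷ q) = cong₂ _∷_ (ℕP.*-distribˡ-+ i a b) (scaled-⊕ (suc i) p q)

coefficientSum-mono : ∀ c → coefficientSum (mono c) ≡ 1ℤ
coefficientSum-mono zero    = refl
coefficientSum-mono (suc c) = trans (ℤP.+-identityˡ (coefficientSum (mono c))) (coefficientSum-mono c)

coefficientSum-scaled-mono : ∀ i c → coefficientSum (scaled i (mono c)) ≡ + (i ℕ.+ c)
coefficientSum-scaled-mono i zero    = cong (λ a → + a) (trans (ℕP.+-identityʳ (i ℕ.* 1)) (trans (ℕP.*-identityʳ i) (sym (ℕP.+-identityʳ i))))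
coefficientSum-scaled-mono i (suc c) = trans (cong (λ a → + a + coefficientSum (scaled (suc i) (mono c))) (ℕP.*-zeroʳ i))
  (trans (ℤP.+-identityˡ (coefficientSum (scaled (suc i) (mono c))))
    (trans (coefficientSum-scaled-mono (suc i) c) (cong (λ a → + a) (sym (ℕP.+-suc i c)))))

coefficientSum-polynomial : ∀ Ps → coefficientSum (foldr _⊕_ [] (map (λ P → mono (contacts P)) Ps)) ≡ total Ps (λ _ → 1ℤ)
coefficientSum-polynomial []       = refl
coefficientSum-polynomial (P ∷ Ps) = trans (coefficientSum-⊕ (mono (contacts P)) (foldr _⊕_ [] (map (λ P → mono (contacts P)) Ps)))
  (cong₂ _+_ (coefficientSum-mono (contacts P)) (coefficientSum-polynomial Ps))

coefficientSum-derivative : ∀ Ps → coefficientSum (scaled 0 (foldr _⊕_ [] (map (λ P → mono (contacts P)) Ps))) ≡ total Ps (λ P → + contacts P)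
coefficientSum-derivative []       = refl
coefficientSum-derivative (P ∷ Ps) = trans (cong (λ p → coefficientSum p) (scaled-⊕ 0 (mono (contacts P)) rest))
  (trans (coefficientSum-⊕ (scaled 0 (mono (contacts P))) (scaled 0 rest))
    (cong₂ _+_ (coefficientSum-scaled-mono 0 (contacts P)) (coefficientSum-derivative Ps)))
  where rest = foldr _⊕_ [] (map (λ P → mono (contacts P)) Ps)

-- Evaluation at κ = 1 in the rationals

toℚᵘ-/ : ∀ i b → ℚ.toℚᵘ (i ℚ./ suc b) ℚᵘ.≃ mkℚᵘ i b
toℚᵘ-/ i b = ℚP.toℚᵘ-fromℚᵘ (mkℚᵘ i b)

/1-+ : ∀ i j → (i ℚ./ 1) ℚ.+ (j ℚ./ 1) ≡ (i + j) ℚ./ 1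
/1-+ i j = ℚP.toℚᵘ-injective (ℚᵘP.≃-trans (ℚP.toℚᵘ-homo-+ (i ℚ./ 1) (j ℚ./ 1))
  (ℚᵘP.≃-trans (ℚᵘP.+-cong (toℚᵘ-/ i 0) (toℚᵘ-/ j 0))
    (ℚᵘP.≃-trans (*≡* (ring i j)) (ℚᵘP.≃-sym (toℚᵘ-/ (i + j) 0)))))
  where
  ring : ∀ i j → (i * 1ℤ + j * 1ℤ) * 1ℤ ≡ (i + j) * (1ℤ * 1ℤ)
  ring = solve-∀

eval-one : ∀ p → eval p 1ℚ ≡ coefficientSum p ℚ./ 1
eval-one []       = refl
eval-one (a ∷ as) = trans (cong (λ q → (+ a ℚ./ 1) ℚ.+ q) (trans (ℚP.*-identityˡ (eval as 1ℚ)) (eval-one as)))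
  (/1-+ (+ a) (coefficientSum as))

eval-Z : ∀ n t y → eval (Z n t y) 1ℚ ≡ count t (ρ n) (flat y n) ℚ./ 1
eval-Z n t y = trans (eval-one (Z n t y))
  (cong (ℚ._/ 1) (trans (coefficientSum-polynomial (families n t y)) (families-count n t y)))

eval-κDZ : ∀ n t y → eval (κD (Z n t y)) 1ℚ ≡ marked t (ρ n) (flat y n) ℚ./ 1
eval-κDZ n t y = trans (eval-one (κD (Z n t y)))
  (cong (ℚ._/ 1) (trans (cong (λ p → coefficientSum p) (κD-scaled (Z n t y)))
    (trans (coefficientSum-derivative (families n t y)) (families-contacts n t y))))

-- Positivity of the number of families with a flat end

χ-nonneg : ∀ h → 0ℤ ℤ.≤ χ h
χ-nonneg h with distinct h
... | true  = ℤ.+≤+ z≤n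
... | false = ℤ.+≤+ z≤n

*-nonneg : ∀ {a b} → 0ℤ ℤ.≤ a → 0ℤ ℤ.≤ b → 0ℤ ℤ.≤ a * b
*-nonneg {+ a} {+ b} _ _ = subst (0ℤ ℤ.≤_) (ℤP.pos-* a b) (ℤ.+≤+ z≤n)

hopℕ-nonneg : ∀ {f : List ℕ → ℤ} → (∀ v → 0ℤ ℤ.≤ f v) → ∀ h → 0ℤ ℤ.≤ hopℕ f h
hopℕ-nonneg p []          = p []
hopℕ-nonneg p (zero ∷ h)  = ℤP.+-mono-≤ (hopℕ-nonneg (λ v → p (1 ∷ v)) h) ℤP.≤-refl
hopℕ-nonneg p (suc a ∷ h) = ℤP.+-mono-≤ (hopℕ-nonneg (λ v → p (2 ℕ.+ a ∷ v)) h) (hopℕ-nonneg (λ v → p (a ∷ v)) h)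

same-nonneg : ∀ x e → 0ℤ ℤ.≤ same x e
same-nonneg []       []       = ℤ.+≤+ z≤n
same-nonneg []       (_ ∷ _)  = ℤ.+≤+ z≤n
same-nonneg (_ ∷ _)  []       = ℤ.+≤+ z≤n
same-nonneg (a ∷ x)  (b ∷ e)  = *-nonneg (kr-nonneg a b) (same-nonneg x e)
  where
  kr-nonneg : ∀ a b → 0ℤ ℤ.≤ kr a b
  kr-nonneg zero    zero    = ℤ.+≤+ z≤n
  kr-nonneg zero    (suc b) = ℤ.+≤+ z≤n
  kr-nonneg (suc a) zero    = ℤ.+≤+ z≤n
  kr-nonneg (suc a) (suc b) = kr-nonneg a b

count-nonneg : ∀ t x e → 0ℤ ℤ.≤ count t x e
count-nonneg zero    x e = *-nonneg (χ-nonneg x) (same-nonneg x e)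
count-nonneg (suc t) x e = *-nonneg (χ-nonneg x) (hopℕ-nonneg (λ v → count-nonneg t v e) x)

hopℕ-rise : ∀ (f : List ℕ → ℤ) → (∀ v → 0ℤ ℤ.≤ f v) → ∀ h → f (map suc h) ℤ.≤ hopℕ f h
hopℕ-rise f p []       = ℤP.≤-refl
hopℕ-rise f p (a ∷ h)  = ℤP.≤-trans (hopℕ-rise (λ v → f (suc a ∷ v)) (λ v → p (suc a ∷ v)) h)
  (subst (ℤ._≤ hopℕ f (a ∷ h)) (ℤP.+-identityʳ (hopℕ (λ v → f (suc a ∷ v)) h)) (ℤP.+-mono-≤ (ℤP.≤-refl {hopℕ (λ v → f (suc a ∷ v)) h}) (rest a)))
  where
  rest : ∀ a → 0ℤ ℤ.≤ below (λ k → hopℕ (λ v → f (k ∷ v)) h) a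
  rest zero    = ℤP.≤-refl
  rest (suc a) = hopℕ-nonneg (λ v → p (a ∷ v)) h

-- The term in which all coordinates fall is present, as all heights in `map suc h` are positive,
-- and the other terms are nonnegative.
hopℕ-fall : ∀ (f : List ℕ → ℤ) → (∀ v → 0ℤ ℤ.≤ f v) → ∀ h → f h ℤ.≤ hopℕ f (map suc h)
hopℕ-fall f p []       = ℤP.≤-refl
hopℕ-fall f p (a ∷ h)  = ℤP.≤-trans (hopℕ-fall (λ v → f (a ∷ v)) (λ v → p (a ∷ v)) h)
  (subst (ℤ._≤ hopℕ f (map suc (a ∷ h))) (ℤP.+-identityˡ (hopℕ (λ v → f (a ∷ v)) (map suc h)))
    (ℤP.+-mono-≤ (hopℕ-nonneg (λ v → p (2 ℕ.+ a ∷ v)) (map suc h)) (ℤP.≤-refl {hopℕ (λ v → f (a ∷ v)) (map suc h)})))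

map-suc-flat : ∀ a n → map suc (flat a n) ≡ flat (suc a) n
map-suc-flat a zero    = refl
map-suc-flat a (suc n) = cong (suc a ∷_) (map-suc-flat (2 ℕ.+ a) n)

parity-pred : ∀ t y → suc t % 2 ≡ suc y % 2 → t % 2 ≡ y % 2
parity-pred zero          zero          _ = refl
parity-pred (suc zero)    (suc zero)    _ = refl
parity-pred (suc (suc t)) y             e = parity-pred t y e
parity-pred zero          (suc (suc y)) e = parity-pred zero y e
parity-pred (suc zero)    (suc (suc y)) e = parity-pred (suc zero) y e

same-refl : ∀ x → same x x ≡ 1ℤ
same-refl []      = refl
same-refl (a ∷ x) = cong₂ _*_ (cong 𝟙 (≡ᵇ-refl a)) (same-refl x)

module _ (n : ℕ) where

  private
    flatCount : ℕ → ℕ → ℤ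
    flatCount t y = count t (ρ n) (flat y n)

  flatCount-rise : ∀ t y → flatCount t y ℤ.≤ flatCount (suc t) (suc y)
  flatCount-rise t y = subst (flatCount t y ℤ.≤_)
    (trans (cong (hopℕ (count t (ρ n))) (map-suc-flat y n)) (sym (count-chamber t (ρ n) (flat (suc y) n) (chamber-flat (suc y) n))))
    (hopℕ-fall (count t (ρ n)) (count-nonneg t (ρ n)) (flat y n))

  flatCount-fall : ∀ t y → flatCount t (suc y) ℤ.≤ flatCount (suc t) y
  flatCount-fall t y = subst₂ ℤ._≤_ (cong (count t (ρ n)) (map-suc-flat y n))
    (sym (count-chamber t (ρ n) (flat y n) (chamber-flat y n)))
    (hopℕ-rise (count t (ρ n)) (count-nonneg t (ρ n)) (flat y n))

  -- All walkers first zigzag, then rise in parallel.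
  flatCount-positive : ∀ t y → y ≤ t → t % 2 ≡ y % 2 → 1ℤ ℤ.≤ flatCount t y
  flatCount-positive zero zero _ _ = ℤP.≤-reflexive
    (sym (cong₂ _*_ (chamber-χ (ρ n) (chamber-flat 0 n)) (same-refl (ρ n))))
  flatCount-positive (suc t) (suc y) (s≤s le) e =
    ℤP.≤-trans (flatCount-positive t y le (parity-pred t y e)) (flatCount-rise t y)
  flatCount-positive (suc (suc t)) zero _ e =
    ℤP.≤-trans (flatCount-positive t 0 z≤n e) (ℤP.≤-trans (flatCount-rise t 0) (flatCount-fall (suc t) 0))

-- The mean as a quotient of rationals

/1-nonzero : ∀ {k} → 1ℤ ℤ.≤ k → k ℚ./ 1 ≢ 0ℚ
/1-nonzero {k} 1≤k e with ℚP.fromℚᵘ-injective {mkℚᵘ k 0} {mkℚᵘ 0ℤ 0} e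
... | *≡* p with trans (sym (ℤP.*-identityʳ k)) p
/1-nonzero (ℤ.+≤+ ()) e | *≡* p | refl

-- On unnormalised fractions the claim becomes the cross-multiplied integer identity, which is the
-- hypothesis rearranged.
fraction : ∀ c k A b → + suc b * (c - k) ≡ A * k → c ℚ./ 1 ≡ (1ℚ ℚ.+ A ℚ./ suc b) ℚ.* (k ℚ./ 1)
fraction c k A b e = ℚP.toℚᵘ-injective (ℚᵘP.≃-trans (toℚᵘ-/ c 0) (ℚᵘP.≃-sym
  (ℚᵘP.≃-trans (ℚP.toℚᵘ-homo-* (1ℚ ℚ.+ A ℚ./ suc b) (k ℚ./ 1))
    (ℚᵘP.≃-trans (ℚᵘP.*-cong (ℚᵘP.≃-trans (ℚP.toℚᵘ-homo-+ 1ℚ (A ℚ./ suc b)) (ℚᵘP.+-cong ℚᵘP.≃-refl (toℚᵘ-/ A b))) (toℚᵘ-/ k 0))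
      (*≡* (trans (left A k (+ suc b)) (trans (cong (λ s → + suc b * k + s) (sym e)) (right c k (+ suc b)))))))))
  where
  left : ∀ A k B → ((1ℤ * B + A * 1ℤ) * k) * 1ℤ ≡ B * k + A * k
  left = solve-∀
  right : ∀ c k B → B * k + B * (c - k) ≡ c * ((1ℤ * B) * 1ℤ)
  right = solve-∀

÷-unique : ∀ p q r → (nz : q ≢ 0ℚ) → p ≡ r ℚ.* q → (p ℚ.÷ q) {{ℚ.≢-nonZero nz}} ≡ r
÷-unique p q r nz e = trans (cong (ℚ._* (ℚ.1/ q)) e)
  (trans (ℚP.*-assoc r q (ℚ.1/ q)) (trans (cong (r ℚ.*_) (ℚP.*-inverseʳ q)) (ℚP.*-identityʳ r)))
  where instance _ = ℚ.≢-nonZero nz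

cleared-ratio : ∀ m t y → y ≤ t → let n = suc m; c = marked t (ρ n) (flat y n); k = count t (ρ n) (flat y n) in
  + ((n ℕ.+ y) ℕ.* (4 ℕ.* n ℕ.+ (t ℕ.+ y))) * (c - k) ≡ + (n ℕ.* (y ℕ.+ 2 ℕ.* n ℕ.+ 1) ℕ.* (t ∸ y)) * k
-- The common factor 2 stems from x + p = 2(y + n) at the top walker.
cleared-ratio m t y y≤t = ℤP.*-cancelˡ-≡ (+ 2) _ _ (begin
  + 2 * (+ ((n ℕ.+ y) ℕ.* (4 ℕ.* n ℕ.+ (t ℕ.+ y))) * d)
    ≡⟨ cong (λ a → + 2 * (a * d)) (trans (ℤP.pos-* (n ℕ.+ y) (4 ℕ.* n ℕ.+ (t ℕ.+ y)))
         (cong (λ a → (+ n + + y) * (a + (+ t + + y))) (ℤP.pos-* 4 n))) ⟩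
  + 2 * (((+ n + + y) * (+ 4 * + n + (+ t + + y))) * d)
    ≡⟨ ring₁ (+ n) (+ t) (+ y) d ⟩
  (+ 2 * (+ y + + n)) * (+ t + + y + + 4 * + n) * d
    ≡⟨ marked-ratio m t y ⟩
  (+ 2 * + n) * (+ t - + y) * (+ y + + 2 * + n + 1ℤ) * k
    ≡⟨ ring₂ (+ n) (+ t - + y) (+ y) k ⟩
  + 2 * ((+ n * (+ y + + 2 * + n + 1ℤ) * (+ t - + y)) * k)
    ≡⟨ cong (λ a → + 2 * (a * k)) (sym (trans (ℤP.pos-* (n ℕ.* (y ℕ.+ 2 ℕ.* n ℕ.+ 1)) (t ∸ y))
         (cong₂ _*_ (trans (ℤP.pos-* n (y ℕ.+ 2 ℕ.* n ℕ.+ 1)) (cong (λ a → + n * (+ y + a + 1ℤ)) (ℤP.pos-* 2 n)))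
           -- Here y ≤ t identifies the truncated difference with the integer one.
           (sym (trans (ℤP.m-n≡m⊖n t y) (ℤP.⊖-≥ y≤t)))))) ⟩
  _ ∎)
  where
  n = suc m
  k = count t (ρ n) (flat y n)
  d = marked t (ρ n) (flat y n) - k
  ring₁ : ∀ n t y d → (+ 2) * (((n + y) * ((+ 4) * n + (t + y))) * d) ≡ ((+ 2) * (y + n)) * (t + y + (+ 4) * n) * d
  ring₁ = solve-∀
  ring₂ : ∀ n s y k → ((+ 2) * n) * s * (y + (+ 2) * n + 1ℤ) * k ≡ (+ 2) * ((n * (y + (+ 2) * n + 1ℤ) * s) * k)
  ring₂ = solve-∀

theorem13 : (n t y : ℕ) → 1 ≤ n → y ≤ t → t % 2 ≡ y % 2 →
    Σ (eval (Z n t y) 1ℚ ≢ 0ℚ) (λ nz → Mbar n t y 1ℚ nz ≡ rhs n t y)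
theorem13 (suc m) t y _ y≤t parity = nz , ÷-unique (eval (κD (Z n t y)) 1ℚ) (eval (Z n t y) 1ℚ) (rhs n t y) nz quotient
  where
  n = suc m
  nz : eval (Z n t y) 1ℚ ≢ 0ℚ
  nz e = /1-nonzero (flatCount-positive n t y y≤t parity) (trans (sym (eval-Z n t y)) e)
  quotient : eval (κD (Z n t y)) 1ℚ ≡ rhs n t y ℚ.* eval (Z n t y) 1ℚ
  quotient = trans (eval-κDZ n t y) (trans
    (fraction (marked t (ρ n) (flat y n)) (count t (ρ n) (flat y n))
      -- `fraction` expects a denominator of the form `suc b`. For n = suc m the product reduces to
      -- a successor, so `ℕ.pred` supplies b definitionally.
      (+ (n ℕ.* (y ℕ.+ 2 ℕ.* n ℕ.+ 1) ℕ.* (t ∸ y))) (ℕ.pred ((n ℕ.+ y) ℕ.* (4 ℕ.* n ℕ.+ (t ℕ.+ y)))) (cleared-ratio m t y y≤t))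
    (cong (rhs n t y ℚ.*_) (sym (eval-Z n t y))))
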